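{- Let $q\ge 2$ be an integer and $k$ a positive integer, and let $M$ be a matroid with (matroid) tree-width at most $k$ and no minor isomorphic to the uniform matroid $U_{2,2+q}$. Then the characteristic polynomial $\chi_M(\lambda)$ is identically zero or else $\chi_M(\lambda)>0$ for all real $\lambda>\frac{q^k-1}{q-1}$.
   Context: For a loopless matroid $M$ with ground set $E$ and rank function $r$, the characteristic polynomial is $\chi_M(\lambda)=\sum_{F\in L}\mu_M(\emptyset,F)\lambda^{r(E)-r(F)}$, where $L$ is the lattice of flats of $M$ and $\mu_M$ its Möbius function; if $M$ has a loop, $\chi_M(\lambda)$ is defined to be $0$. Matroid tree-width: a tree-decomposition of $M$ is a pair $(T,\tau)$ with $T$ a tree and $\tau:E(M)\to V(T)$ an arbitrary map. For a vertex $v$ of $T$, let $T_1,\dots,T_c$ be the components of $T-v$ and $B_j=\{e\in E(M):\tau(e)\in V(T_j)\}$. The rank defect of a set $B$ is $\mathrm{rd}(B)=r(M)-r(E(M)-B)$. The node width of $v$ is $r(M)-\sum_{j=1}^{c}\mathrm{rd}(B_j)$ (equal to $r(M)$ if $T$ has one vertex). The width of $(T,\tau)$ is the maximum node width over the vertices of $T$, and the tree-width $\mathrm{tw}(M)$ is the minimum width over all tree-decompositions of $M$. -}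

module Defs where

open import Level using (Level; _⊔_) renaming (suc to lsuc)
open import Data.Bool using (Bool; true; false; _∧_; _∨_; if_then_else_; not)
open import Data.Nat renaming (_+_ to _+ℕ_) using (ℕ; zero; suc; _∸_; _≤_; _<ᵇ_; _≡ᵇ_; _⊓_)
open import Data.Nat.Properties using ()
open import Data.Integer using (ℤ; +_; -[1+_]) renaming (-_ to -ℤ_)
open import Data.Fin using (Fin; zero; suc; toℕ; _≟_)
open import Data.Fin.Subset using (Subset; inside; outside; ⁅_⁆; _∈_; _∉_; _⊆_; ∁; _∩_; _∪_; ∣_∣; ⊤)
open import Data.Vec using (Vec; []; _∷_; lookup; tabulate)
open import Data.List using (List; []; _∷_; map; _++_; all; any; filter; foldr; concatMap)
open import Data.List.Base using (allFin)
open import Data.Product using (Σ; ∃; _×_; _,_)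
open import Function.Definitions using (Injective)
open import Relation.Nullary using (¬_)
open import Relation.Nullary.Decidable using (⌊_⌋)
open import Relation.Binary.Core using (Rel)
open import Relation.Binary.PropositionalEquality using (_≡_)
open import Relation.Binary.Structures using (IsStrictTotalOrder)
open import Algebra.Bundles using (CommutativeRing)

record Matroid (n : ℕ) : Set where
  field
    rank        : Subset n → ℕ
    rank-bound  : ∀ X → rank X ≤ ∣ X ∣
    rank-mono   : ∀ {X Y} → X ⊆ Y → rank X ≤ rank Y
    rank-submod : ∀ X Y → rank (X ∪ Y) +ℕ rank (X ∩ Y) ≤ rank X +ℕ rank Y

open Matroid public

allSubsets : (n : ℕ) → List (Subset n)
allSubsets zero    = [] ∷ []
allSubsets (suc n) = map (outside ∷_) (allSubsets n) ++ map (inside ∷_) (allSubsets n)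

_⊆ᵇ_ : ∀ {n} → Subset n → Subset n → Bool
_⊆ᵇ_ {n} X Y = all (λ e → not (lookup X e) ∨ lookup Y e) (allFin n)

_⊂ᵇ_ : ∀ {n} → Subset n → Subset n → Bool
X ⊂ᵇ Y = (X ⊆ᵇ Y) ∧ (∣ X ∣ <ᵇ ∣ Y ∣)

module _ {n : ℕ} (M : Matroid n) where

  Loopless : Set
  Loopless = ∀ (e : Fin n) → ¬ (rank M ⁅ e ⁆ ≡ 0)

  loopless? : Bool
  loopless? = all (λ e → 0 <ᵇ rank M ⁅ e ⁆) (allFin n)

  isFlat? : Subset n → Bool
  isFlat? F = all (λ e → lookup F e ∨ (rank M F <ᵇ rank M (F ∪ ⁅ e ⁆))) (allFin n)

  flats : List (Subset n)
  flats = filter (λ F → isFlat? F Data.Bool.≟ true) (allSubsets n)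

  sumℤ : List ℤ → ℤ
  sumℤ = foldr Data.Integer._+_ (+ 0)

  -- μ(∅,F) in the lattice of flats (for loopless M the bottom flat is ∅):
  --   μ(∅,∅) = 1,  μ(∅,F) = - Σ_{G flat, G ⊊ F} μ(∅,G) for F ≠ ∅.
  -- The natural-number argument is fuel; it suffices that it is ≥ |F|.
  μ-aux : ℕ → Subset n → ℤ
  μ-aux zero    F = + 1
  μ-aux (suc k) F =
    if ∣ F ∣ ≡ᵇ 0 then + 1
    else -ℤ sumℤ (map (μ-aux k) (filter (λ G → (G ⊂ᵇ F) Data.Bool.≟ true) flats))

  μ₀ : Subset n → ℤ
  μ₀ F = μ-aux ∣ F ∣ F

record OrderedField c ℓ₁ ℓ₂ : Set (lsuc (c ⊔ ℓ₁ ⊔ ℓ₂)) where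
  field
    commutativeRing : CommutativeRing c ℓ₁
  open CommutativeRing commutativeRing public
  infix 4 _<_
  field
    _<_                : Rel Carrier ℓ₂
    isStrictTotalOrder : IsStrictTotalOrder _≈_ _<_
    +-monoˡ-<          : ∀ {x y} z → x < y → (x + z) < (y + z)
    *-pos              : ∀ {x y} → 0# < x → 0# < y → 0# < (x * y)
    0≉1                : ¬ (0# ≈ 1#)
    inverse            : ∀ x → ¬ (x ≈ 0#) → ∃ λ y → (x * y) ≈ 1#

module _ {c ℓ₁ ℓ₂} (R : OrderedField c ℓ₁ ℓ₂) where
  open OrderedField R

  fromℕ : ℕ → Carrier
  fromℕ zero    = 0#
  fromℕ (suc k) = 1# + fromℕ k

  fromℤ : ℤ → Carrier
  fromℤ (+ k)      = fromℕ k
  fromℤ -[1+ k ]   = - fromℕ (suc k)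

  pow : Carrier → ℕ → Carrier
  pow x zero    = 1#
  pow x (suc k) = x * pow x k

  sumR : List Carrier → Carrier
  sumR = foldr _+_ 0#

  charPoly : ∀ {n} → Matroid n → Carrier → Carrier
  charPoly {n} M x =
    if loopless? M
    then sumR (map (λ F → fromℤ (μ₀ M F) * pow x (rank M ⊤ ∸ rank M F)) (flats M))
    else 0#

uniformRank : (a : ℕ) {b : ℕ} → Subset b → ℕ
uniformRank a X = a ⊓ ∣ X ∣

imageSub : ∀ {m n} → (Fin m → Fin n) → Subset m → Subset n
imageSub {m} φ X = tabulate (λ e → any (λ i → lookup X i ∧ ⌊ φ i ≟ e ⌋) (allFin m))

-- The matroid on Fin m with rank function rN is isomorphic to a minor
-- M / C \ D of M: C is the contracted set, φ is a bijection from Fin m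
-- onto E - C - D (D is the complement of C ∪ im φ), and
-- r_N(X) = r_M(φ[X] ∪ C) - r_M(C).
HasMinorIsoTo : ∀ {m n} → (Subset m → ℕ) → Matroid n → Set
HasMinorIsoTo {m} {n} rN M =
  Σ (Subset n) λ C →
  Σ (Fin m → Fin n) λ φ →
    Injective _≡_ _≡_ φ
    × (∀ i → φ i ∉ C)
    × (∀ X → rank M (imageSub φ X ∪ C) ≡ rN X +ℕ rank M C)

-- A tree with vertex set Fin (suc t): vertex (suc i) is joined to its
-- parent (parent i), which has smaller index.  Every finite tree admits
-- such a labelling (root it and number vertices in BFS order).
record TreeDecomposition {n : ℕ} (M : Matroid n) : Set where
  field
    t         : ℕ
    parent    : Fin t → Fin (suc t)
    parent-lt : ∀ i → toℕ (parent i) ≤ toℕ i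
    τ         : Fin n → Fin (suc t)

  -- w lies in the subtree rooted at u (fuel bounds the depth)
  inSubtree : ℕ → Fin (suc t) → Fin (suc t) → Bool
  inSubtree zero    u w       = ⌊ u ≟ w ⌋
  inSubtree (suc k) u zero    = ⌊ u ≟ zero ⌋
  inSubtree (suc k) u (suc i) = ⌊ u ≟ suc i ⌋ ∨ inSubtree k u (parent i)

  B : Fin (suc t) → Subset n
  B u = tabulate (λ e → inSubtree (suc t) u (τ e))

  rd : Subset n → ℕ
  rd X = rank M ⊤ ∸ rank M (∁ X)

  -- The components of T - v are the subtrees rooted at the children of v,
  -- together with the rest of the tree outside the subtree rooted at v
  -- (whose element set is ∁ (B v); when v is the root it is empty and has rank defect 0).
  nodeWidth : Fin (suc t) → ℕ
  nodeWidth v =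
    rank M ⊤ ∸ (foldr _+ℕ_ 0 (map (λ i → rd (B (suc i)))
                                 (filter (λ i → parent i ≟ v) (allFin t)))
                +ℕ rd (∁ (B v)))

TreeWidth≤ : ∀ {n} → Matroid n → ℕ → Set
TreeWidth≤ M k = Σ (TreeDecomposition M) λ T → ∀ v → TreeDecomposition.nodeWidth T v ≤ k

module Submission where

-- The value χ at x of every minor of M is nonnegative when x > (q^k − 1)/(q − 1), and positive when the
-- minor is loopless, by induction on its size.  Rank defects are superadditive, so the bound on the node
-- widths passes to minors; hence, in a loopless minor of positive rank, a node whose branch has positive
-- rank defect while the branches of its children have none yields a cocircuit inside a set of rank at most k.
-- Let H be its complementary hyperplane and w the value of χ at H.  Deleting the elements of the cocircuit
-- one at a time, the last step gives (x − 1) w, and each other step subtracts the value of a contraction: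
-- at most w, and 0 if the element is parallel to a remaining one.  So χ ≥ (x − d) w, where d is the number
-- of points of the cocircuit, and d ≤ 1 + q + ⋯ + q^(k−1) by Kung's bound.

open import Defs
open import Algebra.Bundles using (CommutativeRing)
import Algebra.Properties.CommutativeSemigroup as CommutativeSemigroupProperties
import Algebra.Properties.Ring as RingProperties
open import Data.Bool using (Bool; true; false; T; if_then_else_; not; _∨_; _∧_)
import Data.Bool as Bool
open import Data.Bool.Properties using (T-≡; T-∧; T-∨; T-not-≡; ∨-identityʳ)
open import Data.Empty using (⊥-elim)
open import Data.Fin using (Fin; zero; suc; toℕ; inject≤)
import Data.Fin.Properties as Fin
open import Data.Fin.Subset using (Subset; inside; outside; ⁅_⁆; _∈_; _∉_; _⊆_; _⊂_; ∁; _∩_; _∪_; ∣_∣; ⊤; ⊥)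
open import Data.Fin.Subset.Properties
import Data.Integer as ℤ
import Data.Integer.Properties as ℤ
open import Data.List using (List; []; _∷_; _++_; length; lookup; filter; allFin; sum; map; foldr; tabulate)
open import Data.List.Membership.Propositional using (find) renaming (_∈_ to _∈ₗ_)
open import Data.List.Membership.Propositional.Properties
  using (∈-lookup; ∈-filter⁺; ∈-filter⁻; ∈-allFin; ∈-++⁺ˡ; ∈-++⁺ʳ)
open import Data.List.Properties using (length-++; length-filter; partition-defn; map-∘; map-tabulate)
open import Data.List.Relation.Binary.Permutation.Propositional as Perm
  using (_↭_; ↭ₛ⇒↭; ↭-sym; ↭-trans; prep; swap)
open import Data.List.Relation.Binary.Permutation.Propositional.Properties using (↭-length; shift; ∈-resp-↭)
import Data.List.Relation.Binary.Permutation.Setoid.Properties as PermSetoid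
open import Data.List.Relation.Unary.All as All using (All; []; _∷_)
import Data.List.Relation.Unary.All.Properties as All
open import Data.List.Relation.Unary.AllPairs as AllPairs using (AllPairs; []; _∷_)
import Data.List.Relation.Unary.AllPairs.Properties as AllPairs
open import Data.List.Relation.Unary.Any as Any using (here; there; satisfied)
open import Data.List.Relation.Unary.Any.Properties using (any⁺; any⁻)
open import Data.Nat using (ℕ; zero; suc; _∸_)
import Data.Nat as ℕ
import Data.Nat.Properties as ℕ
open import Data.Nat.Tactic.RingSolver using (solve-∀)
open import Data.Product using (∃; _×_; _,_; proj₁; proj₂)
open import Data.Sum using (_⊎_; inj₁; inj₂; [_,_]′) renaming (map to ⊎-map)
open import Data.Vec using ([]; _∷_)
import Data.Vec as Vec
import Data.Vec.Properties as Vec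
open import Function using (_∘_; id; _on_)
open import Function.Bundles using (Equivalence)
open import Level using (Level)
import Relation.Binary.Construct.StrictToNonStrict as StrictToNonStrict
open import Relation.Binary.Definitions using (tri<; tri≈; tri>)
open import Relation.Binary.PropositionalEquality as ≡ using (_≡_; _≢_)
import Relation.Binary.Reasoning.Setoid as ≈-Reasoning
open import Relation.Binary.Structures using (IsStrictTotalOrder)
open import Relation.Nullary using (¬_; Dec; yes; no; does; contradiction; ¬?)
open import Relation.Nullary.Decidable using (⌊_⌋; _×-dec_; toWitness; fromWitness; decidable-stable)
open import Relation.Unary using (Decidable)

-- No minor is built as a matroid. A set `C` and a list `L` stand for the minor (M / C) | L, whose
-- ranks are read off from `M`; the tree-decomposition and the excluded line are always those of `M`
-- itself. Hence the width bound has to be transferred by inequalities between rank defects taken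
-- relative to `C` and to the union of `C` with `L`. Contracting an element of a loopless minor may
-- create loops, so positivity alone does not survive the induction. Nonnegativity of all minors
-- controls the contraction terms, while strict positivity is needed only for a hyperplane, which is
-- a restriction and so stays loopless. The induction runs on Whitney's signed sum over all subsets,
-- where deletion and contraction are the two halves of the sum. The definition by flats and the
-- Möbius function would require following flats through minors. That the two agree is needed only
-- once, for `M` itself, and is proved by grouping subsets according to their closure.

module Minors where
  open import Data.Nat using (_+_; _*_; _^_; _⊓_; _≤_; _<_; z≤n; s≤s; s≤s⁻¹; _≤?_)
  open import Data.Nat.Properties
  open ≡ using (refl; sym; trans; cong; subst; setoid)

  private variable
    n : ℕ
    X Y U C : Subset n

  -- Unions of subsets, and ranks in contractions.

  ∪-⊆ : X ⊆ U → Y ⊆ U → X ∪ Y ⊆ U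
  ∪-⊆ X⊆U Y⊆U = [ X⊆U , Y⊆U ]′ ∘ x∈p∪q⁻ _ _

  ∪-mono : ∀ {X X′ Y Y′ : Subset n} → X ⊆ X′ → Y ⊆ Y′ → X ∪ Y ⊆ X′ ∪ Y′
  ∪-mono {X′ = X′} {Y′ = Y′} X⊆X′ Y⊆Y′ = ∪-⊆ (p⊆p∪q Y′ ∘ X⊆X′) (q⊆p∪q X′ Y′ ∘ Y⊆Y′)

  ∩-greatest : U ⊆ X → U ⊆ Y → U ⊆ X ∩ Y
  ∩-greatest U⊆X U⊆Y x∈U = x∈p∩q⁺ (U⊆X x∈U , U⊆Y x∈U)

  ⁅⁆-⊆ : ∀ {e : Fin n} → e ∈ U → ⁅ e ⁆ ⊆ U
  ⁅⁆-⊆ {U = U} e∈U x∈⁅e⁆ = subst (_∈ U) (sym (x∈⁅y⁆⇒x≡y _ x∈⁅e⁆)) e∈U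

  ∈-tabulate⁺ : ∀ {f : Fin n → Bool} {e} → T (f e) → e ∈ Vec.tabulate f
  ∈-tabulate⁺ {f = f} {e} fe =
    Vec.lookup⇒[]= e _ (trans (Vec.lookup∘tabulate f e) (Equivalence.to T-≡ fe))

  ∈-tabulate⁻ : ∀ {f : Fin n → Bool} {e} → e ∈ Vec.tabulate f → T (f e)
  ∈-tabulate⁻ {f = f} {e} e∈ =
    Equivalence.from T-≡ (trans (sym (Vec.lookup∘tabulate f e)) (Vec.[]=⇒lookup e∈))

  ∈-imageSub⁺ : ∀ {m} (φ : Fin m → Fin n) {X i} → i ∈ X → φ i ∈ imageSub φ X
  ∈-imageSub⁺ φ {X} {i} i∈X = ∈-tabulate⁺ (any⁺ (λ j → Vec.lookup X j ∧ ⌊ φ j Fin.≟ φ i ⌋) (Any.map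
    (λ { refl → Equivalence.from T-∧ (Equivalence.from T-≡ (Vec.[]=⇒lookup i∈X) , fromWitness refl) })
    (∈-allFin i)))

  ∈-imageSub⁻ : ∀ {m} (φ : Fin m → Fin n) {X e} → e ∈ imageSub φ X → ∃ λ i → i ∈ X × φ i ≡ e
  ∈-imageSub⁻ φ {X} {e} e∈
    with i , i∈ ← satisfied (any⁻ (λ i → Vec.lookup X i ∧ ⌊ φ i Fin.≟ e ⌋) (allFin _) (∈-tabulate⁻ e∈))
    with i∈X , φi≡e ← Equivalence.to (T-∧ {Vec.lookup X i}) i∈ =
    i , Vec.lookup⇒[]= i X (Equivalence.to T-≡ i∈X) , toWitness φi≡e

  filter-↭ : ∀ {a p} {A : Set a} {P : A → Set p} (P? : Decidable P) xs →
             xs ↭ filter P? xs ++ filter (¬? ∘ P?) xs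
  filter-↭ P? xs =
    subst (λ p → xs ↭ proj₁ p ++ proj₂ p) (partition-defn P? xs)
      (↭ₛ⇒↭ (PermSetoid.partition-↭ (setoid _) P? xs))

  length-filter-¬ : ∀ {a p} {A : Set a} {P : A → Set p} (P? : Decidable P) xs →
                    length (filter (¬? ∘ P?) xs) + length (filter P? xs) ≡ length xs
  length-filter-¬ P? xs = trans (+-comm (length (filter (¬? ∘ P?) xs)) _)
    (trans (sym (length-++ (filter P? xs))) (sym (↭-length (filter-↭ P? xs))))

  infixl 6 _⊹_

  _⊹_ : Subset n → Fin n → Subset n
  C ⊹ e = C ∪ ⁅ e ⁆

  -- A plain union, without closure. Folding the entries into `C` makes `span C (e ∷ L)` and
  -- `span (C ⊹ e) L` the same term, so contracting `e` leaves the top rank unchanged by definition.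
  span : Subset n → List (Fin n) → Subset n
  span C []      = C
  span C (e ∷ L) = span (C ⊹ e) L

  ⊆-⊹ : ∀ {e} → C ⊆ C ⊹ e
  ⊆-⊹ = p⊆p∪q _

  ∈-⊹ : ∀ {e} → e ∈ C ⊹ e
  ∈-⊹ {e = e} = q⊆p∪q _ _ (x∈⁅x⁆ e)

  ⊹-⊆ : ∀ {e} → C ⊆ U → e ∈ U → C ⊹ e ⊆ U
  ⊹-⊆ C⊆U e∈U = ∪-⊆ C⊆U (⁅⁆-⊆ e∈U)

  ⊹-mono : ∀ {e} → X ⊆ Y → X ⊹ e ⊆ Y ⊹ e
  ⊹-mono X⊆Y = ∪-mono X⊆Y id

  ⊹-swap-⊆ : ∀ {e f} → C ⊹ e ⊹ f ⊆ C ⊹ f ⊹ e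
  ⊹-swap-⊆ = ⊹-⊆ (⊹-mono ⊆-⊹) (⊆-⊹ ∈-⊹)

  ⊹-comm : ∀ (C : Subset n) e f → C ⊹ e ⊹ f ≡ C ⊹ f ⊹ e
  ⊹-comm C e f = ⊆-antisym (⊹-swap-⊆ {C = C}) (⊹-swap-⊆ {C = C})

  span-⊆ : ∀ {L} → C ⊆ U → All (_∈ U) L → span C L ⊆ U
  span-⊆ C⊆U []          = C⊆U
  span-⊆ C⊆U (e∈U ∷ L⊆U) = span-⊆ (⊹-⊆ C⊆U e∈U) L⊆U

  ⊆-span : ∀ L → C ⊆ span C L
  ⊆-span []      = id
  ⊆-span (e ∷ L) = ⊆-span L ∘ ⊆-⊹

  ∈-span : ∀ {L e} → e ∈ₗ L → e ∈ span C L
  ∈-span {L = _ ∷ L} (here refl)  = ⊆-span L ∈-⊹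
  ∈-span             (there e∈L)  = ∈-span e∈L

  All-∈-span : ∀ L → All (_∈ span C L) L
  All-∈-span L = All.tabulate ∈-span

  span-mono : ∀ (C : Subset n) L L′ → (∀ {e} → e ∈ₗ L → e ∈ₗ L′) → span C L ⊆ span C L′
  span-mono C L L′ L⊆L′ = span-⊆ {L = L} (⊆-span L′) (All.tabulate (∈-span ∘ L⊆L′))

  module _ {n} (M : Matroid n) where

    -- `e` is a nonloop of M / C, that is, `e` lies outside the closure of `C`.
    Nonloop : Subset n → Fin n → Set
    Nonloop C e = rank M C < rank M (C ⊹ e)

    nonloop? : ∀ C e → Dec (Nonloop C e)
    nonloop? C e = suc (rank M C) ≤? rank M (C ⊹ e)

    -- For nonloops of M / C this says that they are not parallel there.
    Indep : Subset n → Fin n → Fin n → Set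
    Indep C e f = 2 + rank M C ≤ rank M (C ⊹ e ⊹ f)

    indep? : ∀ C e f → Dec (Indep C e f)
    indep? C e f = 2 + rank M C ≤? rank M (C ⊹ e ⊹ f)

    rank-submod-⊆ : ∀ {U I} X Y → U ⊆ X ∪ Y → I ⊆ X ∩ Y → rank M U + rank M I ≤ rank M X + rank M Y
    rank-submod-⊆ X Y U⊆ I⊆ =
      ≤-trans (+-mono-≤ (rank-mono M U⊆) (rank-mono M I⊆)) (rank-submod M X Y)

    rank-span-mono : ∀ C L L′ → (∀ {e} → e ∈ₗ L → e ∈ₗ L′) → rank M (span C L) ≤ rank M (span C L′)
    rank-span-mono C L L′ L⊆L′ = rank-mono M (span-mono C L L′ L⊆L′)

    rank-⊹-≤ : ∀ C e → rank M (C ⊹ e) ≤ suc (rank M C)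
    rank-⊹-≤ C e = begin
      rank M (C ⊹ e)                        ≤⟨ m≤m+n _ _ ⟩
      rank M (C ⊹ e) + rank M (C ∩ ⁅ e ⁆)   ≤⟨ rank-submod M C ⁅ e ⁆ ⟩
      rank M C + rank M ⁅ e ⁆               ≤⟨ +-monoʳ-≤ (rank M C) (rank-bound M ⁅ e ⁆) ⟩
      rank M C + ∣ ⁅ e ⁆ ∣                  ≡⟨ cong (rank M C +_) (∣⁅x⁆∣≡1 e) ⟩
      rank M C + 1                          ≡⟨ +-comm (rank M C) 1 ⟩
      suc (rank M C)                        ∎
      where open ≤-Reasoning

    nonloop-rank : ∀ {C e} → Nonloop C e → rank M (C ⊹ e) ≡ suc (rank M C)
    nonloop-rank {C} {e} = ≤-antisym (rank-⊹-≤ C e)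

    -- Submodularity, applied to `D` and `C ⊹ e`, makes the rank gained from `e` shrink as the set
    -- grows.
    nonloop-⊆ : ∀ {C D e} → C ⊆ D → Nonloop D e → Nonloop C e
    nonloop-⊆ {C} {D} {e} C⊆D e∉D = +-cancelˡ-≤ (rank M D) _ _ (begin
      rank M D + suc (rank M C)       ≡⟨ +-suc _ _ ⟩
      suc (rank M D) + rank M C       ≤⟨ +-monoˡ-≤ (rank M C) e∉D ⟩
      rank M (D ⊹ e) + rank M C       ≤⟨ rank-submod-⊆ D (C ⊹ e) (∪-mono id (q⊆p∪q C _)) (∩-greatest C⊆D ⊆-⊹) ⟩
      rank M D + rank M (C ⊹ e)       ∎)
      where open ≤-Reasoning

    loop-⊆ : ∀ {C D e} → C ⊆ D → ¬ Nonloop C e → ¬ Nonloop D e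
    loop-⊆ C⊆D e∈clC = e∈clC ∘ nonloop-⊆ C⊆D

    loop-rank : ∀ {C e} → ¬ Nonloop C e → rank M (C ⊹ e) ≡ rank M C
    loop-rank e∈clC = ≤-antisym (≮⇒≥ e∈clC) (rank-mono M ⊆-⊹)

    rank-span-loops : ∀ {C L} → All (¬_ ∘ Nonloop C) L → rank M (span C L) ≡ rank M C
    rank-span-loops []               = refl
    rank-span-loops (e∈clC ∷ L⊆clC) =
      trans (rank-span-loops (All.map (loop-⊆ ⊆-⊹) L⊆clC)) (loop-rank e∈clC)

    indep-sym : ∀ {C e f} → Indep C e f → Indep C f e
    indep-sym {C} {e} {f} = subst (λ X → 2 + rank M C ≤ rank M X) (⊹-comm C e f)

    indep-irrefl : ∀ {C e} → ¬ Indep C e e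
    indep-irrefl {C} {e} ind = <-irrefl refl
      (≤-trans ind (≤-trans (rank-mono M (⊹-⊆ id ∈-⊹)) (rank-⊹-≤ C e)))

    indep⇒nonloop : ∀ {C e f} → Indep C e f → Nonloop (C ⊹ e) f
    indep⇒nonloop {C} {e} ind = ≤-trans (s≤s (rank-⊹-≤ C e)) ind

    ¬indep⇒loop : ∀ {C e f} → Nonloop C e → ¬ Indep C e f → ¬ Nonloop (C ⊹ e) f
    ¬indep⇒loop e∉clC ¬ind f∉ = ¬ind (≤-trans (s≤s e∉clC) f∉)

  -- Kung's bound on the number of points.

  AllPairs-lookup-< : ∀ {a ℓ} {A : Set a} {R : A → A → Set ℓ} {L : List A} → AllPairs R L →
                      ∀ i j → toℕ i < toℕ j → R (lookup L i) (lookup L j)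
  AllPairs-lookup-< {L = x ∷ L} (Rx ∷ RL) zero    (suc j) _         = All.lookup Rx (∈-lookup {xs = L} j)
  AllPairs-lookup-<             (Rx ∷ RL) (suc i) (suc j) (s≤s i<j) = AllPairs-lookup-< RL i j i<j

  AllPairs-lookup-≢ : ∀ {a ℓ} {A : Set a} {R : A → A → Set ℓ} → (∀ {x y} → R x y → R y x) →
                      ∀ {L} → AllPairs R L → ∀ {i j} → i ≢ j → R (lookup L i) (lookup L j)
  AllPairs-lookup-≢ R-sym RL {i} {j} i≢j with <-cmp (toℕ i) (toℕ j)
  ... | tri< i<j _ _ = AllPairs-lookup-< RL i j i<j
  ... | tri≈ _ i≡j _ = contradiction (Fin.toℕ-injective i≡j) i≢j
  ... | tri> _ _ j<i = R-sym (AllPairs-lookup-< RL j i j<i)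

  module _ {n} (M : Matroid n) {q} (noLine : ¬ HasMinorIsoTo (uniformRank 2 {2 + q}) M) where

    -- Otherwise contracting `C` and keeping the first `q + 2` entries of `L` would give the
    -- excluded line.
    line-length : ∀ {C U L} → All (_∈ U) L → C ⊆ U → rank M U ≤ 2 + rank M C →
                  All (Nonloop M C) L → AllPairs (Indep M C) L → length L ≤ suc q
    line-length {C} {U} {L} L⊆U C⊆U rU≤ L∉clC ind with length L ≤? suc q
    ... | yes L≤ = L≤
    ... | no  L≰ = contradiction (C , φ , (λ {i} {j} → φ-injective {i} {j}) , φ∉C , rank-image) noLine
      where
      open ≤-Reasoning
      φ : Fin (2 + q) → Fin n
      φ i = lookup L (inject≤ i (≰⇒> L≰))

      φ-nonloop : ∀ i → Nonloop M C (φ i)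
      φ-nonloop i = All.lookup L∉clC (∈-lookup {xs = L} _)

      φ-indep : ∀ {i j} → i ≢ j → Indep M C (φ i) (φ j)
      φ-indep i≢j = AllPairs-lookup-≢ (indep-sym M) ind (i≢j ∘ Fin.inject≤-injective _ _ _ _)

      φ-injective : ∀ {i j} → φ i ≡ φ j → i ≡ j
      φ-injective {i} {j} φi≡φj with i Fin.≟ j
      ... | yes i≡j = i≡j
      ... | no  i≢j = contradiction (subst (Indep M C (φ i)) (sym φi≡φj) (φ-indep i≢j)) (indep-irrefl M)

      φ∉C : ∀ i → φ i ∉ C
      φ∉C i φi∈C = <-irrefl refl (≤-trans (φ-nonloop i) (rank-mono M (⊹-⊆ id φi∈C)))

      rank-image : ∀ X → rank M (imageSub φ X ∪ C) ≡ uniformRank 2 X + rank M C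
      -- The cases |X| = 0, |X| = 1 and |X| at least 2 yield the three values of the rank function
      -- of the line.
      rank-image X with nonempty? X
      ... | no  empty rewrite Empty-unique empty | ∣⊥∣≡0 (2 + q) = ≤-antisym
        (rank-mono M (∪-⊆ (λ e∈ → ⊥-elim (∉⊥ (proj₁ (proj₂ (∈-imageSub⁻ φ {⊥} e∈))))) id))
        (rank-mono M (q⊆p∪q _ C))
      ... | yes (i , i∈X) with Fin.any? (λ j → (j ∈? X) ×-dec ¬? (i Fin.≟ j))
      ...   | no  none = trans (cong (λ Y → rank M (imageSub φ Y ∪ C)) X≡⁅i⁆)
                           (trans rank-⁅i⁆ (cong (λ m → 2 ⊓ m + rank M C) (sym (trans (cong ∣_∣ X≡⁅i⁆) (∣⁅x⁆∣≡1 i)))))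
        where
        only-i : X ⊆ ⁅ i ⁆
        only-i {j} j∈X with i Fin.≟ j
        ... | yes refl = x∈⁅x⁆ j
        ... | no  i≢j  = ⊥-elim (none (j , j∈X , i≢j))
        X≡⁅i⁆ : X ≡ ⁅ i ⁆
        X≡⁅i⁆ = ⊆-antisym only-i (⁅⁆-⊆ i∈X)
        image⊆ : ∀ {e} → (∃ λ j → j ∈ ⁅ i ⁆ × φ j ≡ e) → e ∈ C ⊹ φ i
        image⊆ (j , j∈ , refl) rewrite x∈⁅y⁆⇒x≡y i j∈ = ∈-⊹
        rank-⁅i⁆ : rank M (imageSub φ ⁅ i ⁆ ∪ C) ≡ 1 + rank M C
        rank-⁅i⁆ = trans (≤-antisym
          (rank-mono M (∪-⊆ (λ e∈ → image⊆ (∈-imageSub⁻ φ e∈)) ⊆-⊹))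
          (rank-mono M (⊹-⊆ (q⊆p∪q _ C) (p⊆p∪q C (∈-imageSub⁺ φ (x∈⁅x⁆ i))))))
          (nonloop-rank M (φ-nonloop i))
      ...   | yes (j , j∈X , i≢j) = trans (≤-antisym
          (≤-trans (rank-mono M (∪-⊆ (λ e∈ → image⊆ (∈-imageSub⁻ φ {X} e∈)) C⊆U)) rU≤)
          (≤-trans (φ-indep i≢j)
            (rank-mono M (⊹-⊆ (⊹-⊆ (q⊆p∪q _ C) (p⊆p∪q C (∈-imageSub⁺ φ i∈X))) (p⊆p∪q C (∈-imageSub⁺ φ j∈X))))))
          (cong (_+ rank M C) (sym (m≤n⇒m⊓n≡m 2≤∣X∣)))
        where
        2≤∣X∣ : 2 ≤ ∣ X ∣
        2≤∣X∣ = subst (_< ∣ X ∣) (∣⁅x⁆∣≡1 i)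
          (p⊂q⇒∣p∣<∣q∣ (⁅⁆-⊆ i∈X , j , j∈X , i≢j ∘ sym ∘ x∈⁅y⁆⇒x≡y i))
        image⊆ : ∀ {e} → (∃ λ j → j ∈ X × φ j ≡ e) → e ∈ U
        image⊆ (j , _ , refl) = All.lookup L⊆U (∈-lookup {xs = L} _)

    -- `R` takes one element from each line through `e` in M / C. Contracting `e` turns these lines
    -- into distinct points, and each line carries at most `q` entries besides `e`. The bound `m`
    -- makes the recursion on the filtered list structural.
    pencil : ∀ {C e} m L → length L ≤ m → All (Nonloop M C) (e ∷ L) → AllPairs (Indep M C) (e ∷ L) →
             ∃ λ R → (∀ {f} → f ∈ₗ R → f ∈ₗ L) × AllPairs (Indep M (C ⊹ e)) R × length L ≤ q * length R
    pencil m [] _ _ _ = [] , id , [] , z≤n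
    pencil {C} {e} (suc m) (f ∷ L) (s≤s L≤m) (e∉ ∷ f∉ ∷ L∉) ((ef ∷ eL) ∷ fL ∷ LL) =
      f ∷ R , f∷R⊆ , All.tabulate (λ g∈R → proj₂ (∈-filter⁻ _ {xs = L} (R⊆ g∈R))) ∷ RR , count
      where
      open ≤-Reasoning
      rest line : List (Fin n)
      rest = filter (indep? M (C ⊹ e) f) L
      line = filter (¬? ∘ indep? M (C ⊹ e) f) L

      rec = pencil {C} {e} m rest (≤-trans (length-filter (indep? M (C ⊹ e) f) L) L≤m)
              (e∉ ∷ All.filter⁺ _ L∉) (All.filter⁺ _ eL ∷ AllPairs.filter⁺ _ LL)
      R : List (Fin n)
      R = proj₁ rec
      R⊆ : ∀ {g} → g ∈ₗ R → g ∈ₗ rest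
      R⊆ = proj₁ (proj₂ rec)
      RR : AllPairs (Indep M (C ⊹ e)) R
      RR = proj₁ (proj₂ (proj₂ rec))
      L≤ : length rest ≤ q * length R
      L≤ = proj₂ (proj₂ (proj₂ rec))

      f∷R⊆ : ∀ {g} → g ∈ₗ f ∷ R → g ∈ₗ f ∷ L
      f∷R⊆ (here g≡f)  = here g≡f
      f∷R⊆ (there g∈R) = there (proj₁ (∈-filter⁻ _ {xs = L} (R⊆ g∈R)))

      rank-line : rank M (span (C ⊹ e ⊹ f) line) ≤ 2 + rank M C
      rank-line = begin
        rank M (span (C ⊹ e ⊹ f) line)
          ≡⟨ rank-span-loops M (All.map (¬indep⇒loop M (indep⇒nonloop M ef)) (All.all-filter _ L)) ⟩
        rank M (C ⊹ e ⊹ f)            ≤⟨ rank-⊹-≤ M (C ⊹ e) f ⟩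
        suc (rank M (C ⊹ e))          ≤⟨ s≤s (rank-⊹-≤ M C e) ⟩
        2 + rank M C                  ∎

      -- `e`, `f` and `line` together have rank at most 2 over `C`, so they number at most `q + 1`;
      -- setting `e` aside leaves `q`.
      line≤q : length (f ∷ line) ≤ q
      line≤q = s≤s⁻¹ (line-length
        (⊆-span line (⊆-⊹ ∈-⊹) ∷ ⊆-span line ∈-⊹ ∷ All-∈-span line)
        (⊆-span line ∘ ⊆-⊹ ∘ ⊆-⊹) rank-line
        (e∉ ∷ f∉ ∷ All.filter⁺ _ L∉)
        ((ef ∷ All.filter⁺ _ eL) ∷ All.filter⁺ _ fL ∷ AllPairs.filter⁺ _ LL))

      count : length (f ∷ L) ≤ q * length (f ∷ R)
      count = begin
        suc (length L)                   ≡⟨ cong suc (length-filter-¬ (indep? M (C ⊹ e) f) L) ⟨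
        length (f ∷ line) + length rest  ≤⟨ +-mono-≤ line≤q L≤ ⟩
        q + q * length R                 ≡⟨ *-suc q (length R) ⟨
        q * suc (length R)               ∎

  -- 1 + q + ... + q^(k-1) in Horner form, the shape in which contracting one element at a time
  -- produces the bound.
  geometric : ℕ → ℕ → ℕ
  geometric q zero    = 0
  geometric q (suc k) = suc (q * geometric q k)

  geometric-pow : ∀ q k → q * geometric (suc q) k ≡ suc q ^ k ∸ 1
  geometric-pow q k = cong (_∸ 1) (closed k)
    where
    open ≤-Reasoning
    closed : ∀ k → suc (q * geometric (suc q) k) ≡ suc q ^ k
    closed zero    = cong suc (*-zeroʳ q)
    closed (suc k) = begin-equality
      suc (q * suc (suc q * g))        ≡⟨ cong suc (*-suc q _) ⟩
      suc q + q * (suc q * g)          ≡⟨ cong (suc q +_) (sym (*-assoc q (suc q) g)) ⟩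
      suc q + q * suc q * g            ≡⟨ cong (λ m → suc q + m * g) (*-comm q (suc q)) ⟩
      suc q + suc q * q * g            ≡⟨ cong (suc q +_) (*-assoc (suc q) q g) ⟩
      suc q + suc q * (q * g)          ≡⟨ *-suc (suc q) (q * g) ⟨
      suc q * suc (q * g)              ≡⟨ cong (suc q *_) (closed k) ⟩
      suc q * suc q ^ k                ∎
      where g = geometric (suc q) k

  module _ {n} (M : Matroid n) {q} (noLine : ¬ HasMinorIsoTo (uniformRank 2 {2 + q}) M) where

    -- Projection from the first entry: contracting it lowers the available rank by one, and passing
    -- to one element per line through it loses at most a factor `q`. This is the recursion of
    -- `geometric`.
    kung : ∀ k {C U} L → C ⊆ U → All (_∈ U) L → rank M U ≤ k + rank M C →
           All (Nonloop M C) L → AllPairs (Indep M C) L → length L ≤ geometric q k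
    kung k       []      _   _           _   _        _   = z≤n
    kung zero    (e ∷ L) C⊆U (e∈U ∷ _)   rU≤ (e∉ ∷ _) _   = contradiction
      (≤-trans e∉ (≤-trans (rank-mono M (⊹-⊆ C⊆U e∈U)) rU≤)) (<-irrefl refl)
    kung (suc k) {C} {U} (e ∷ L) C⊆U (e∈U ∷ L⊆U) rU≤ L∉ (eL ∷ LL)
      with R , R⊆L , RR , L≤ ← pencil M noLine (length L) L ≤-refl L∉ (eL ∷ LL) =
      s≤s (≤-trans L≤ (*-monoʳ-≤ q (kung k {C ⊹ e} {U} R (⊹-⊆ C⊆U e∈U)
        (All.tabulate (All.lookup L⊆U ∘ R⊆L))
        (≤-trans rU≤ (≤-trans (≤-reflexive (sym (+-suc k _))) (+-monoʳ-≤ k (All.head L∉))))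
        (All.tabulate (λ f∈R → indep⇒nonloop M (All.lookup eL (R⊆L f∈R))))
        RR)))

  -- Rank defects, their superadditivity and their behaviour in minors.

  Disjoint : ∀ {n} → Subset n → Subset n → Set
  Disjoint X Y = ∀ {e} → e ∈ X → e ∉ Y

  AllPairs-with-All : ∀ {a p ℓ ℓ′} {A : Set a} {P : A → Set p} {R : A → A → Set ℓ} {S : A → A → Set ℓ′} →
                      (∀ {x y} → P x → P y → R x y → S x y) →
                      ∀ {L} → All P L → AllPairs R L → AllPairs S L
  AllPairs-with-All f []         []         = []
  AllPairs-with-All f (px ∷ pL) (Rx ∷ RL) =
    All.zipWith (λ (py , Rxy) → f px py Rxy) (pL , Rx) ∷ AllPairs-with-All f pL RL

  last-satisfying : ∀ {p m} {P : Fin m → Set p} → Decidable P → ∃ P →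
                    ∃ λ v → P v × (∀ w → toℕ v < toℕ w → ¬ P w)
  last-satisfying {m = suc m} P? (v , Pv) with Fin.any? (P? ∘ suc)
  ... | yes ∃P with w , Pw , later ← last-satisfying (P? ∘ suc) ∃P =
    suc w , Pw , λ { (suc x) (s≤s w<x) → later x w<x }
  last-satisfying {m = suc m} P? (zero  , Pv) | no ∄P = zero , Pv , λ { (suc x) _ Px → ∄P (x , Px) }
  last-satisfying {m = suc m} P? (suc v , Pv) | no ∄P = contradiction (v , Pv) ∄P

  module _ {n} (f : Subset n → ℕ) where

    defect : Subset n → ℕ
    defect X = f ⊤ ∸ f (∁ X)

    -- Each step applies submodularity to `∁ X` and the intersection `I` of the other complements;
    -- disjointness makes their union everything. Keeping the value at the last intersection closes
    -- the induction. The function is abstract because it will send `X` to r(Z ∪ X) and to r(C ∩ X).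
    defect-superadditive : (∀ {X Y} → X ⊆ Y → f X ≤ f Y) →
      (∀ X Y → f (X ∪ Y) + f (X ∩ Y) ≤ f X + f Y) →
      ∀ Xs → AllPairs Disjoint Xs → sum (map defect Xs) + f (foldr (λ X → ∁ X ∩_) ⊤ Xs) ≤ f ⊤
    defect-superadditive mono submod []       _ = ≤-refl
    defect-superadditive mono submod (X ∷ Xs) (X# ∷ Xs#) = begin
      (defect X + S) + f (∁ X ∩ I)  ≡⟨ shuffle (defect X) S (f (∁ X ∩ I)) ⟩
      S + (defect X + f (∁ X ∩ I))  ≤⟨ +-monoʳ-≤ S step ⟩
      S + f I                       ≤⟨ defect-superadditive mono submod Xs Xs# ⟩
      f ⊤                           ∎
      where
      open ≤-Reasoning
      S = sum (map defect Xs)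
      I = foldr (λ X → ∁ X ∩_) ⊤ Xs
      shuffle : ∀ a b c → (a + b) + c ≡ b + (a + c)
      shuffle = solve-∀
      X⊆ : ∀ {Ys} → All (Disjoint X) Ys → X ⊆ foldr (λ Y → ∁ Y ∩_) ⊤ Ys
      X⊆ []             x∈X = ∈⊤
      X⊆ (X#Y ∷ X#Ys) x∈X = x∈p∩q⁺ (x∉p⇒x∈∁p (X#Y x∈X) , X⊆ X#Ys x∈X)
      covers : ⊤ ⊆ ∁ X ∪ I
      covers {e} _ with e ∈? X
      ... | yes e∈X = q⊆p∪q (∁ X) I (X⊆ X# e∈X)
      ... | no  e∉X = p⊆p∪q I (x∉p⇒x∈∁p e∉X)
      step : defect X + f (∁ X ∩ I) ≤ f I
      step = +-cancelˡ-≤ (f (∁ X)) _ _ (begin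
        f (∁ X) + (defect X + f (∁ X ∩ I))  ≡⟨ +-assoc (f (∁ X)) _ _ ⟨
        f (∁ X) + defect X + f (∁ X ∩ I)    ≡⟨ cong (_+ f (∁ X ∩ I)) (m+[n∸m]≡n (mono ⊆⊤)) ⟩
        f ⊤ + f (∁ X ∩ I)                   ≤⟨ +-monoˡ-≤ _ (mono covers) ⟩
        f (∁ X ∪ I) + f (∁ X ∩ I)           ≤⟨ submod (∁ X) I ⟩
        f (∁ X) + f I                       ∎)

  -- The rank defect in M is bounded by the sum of the defects in M / Z, in M | C and in the minor
  -- (M | Z) / C; superadditivity of the first two transfers the bound on the node width to this minor.
  module _ {n} (M : Matroid n) {C Z : Subset n} (C⊆Z : C ⊆ Z) where

    private
      r     = rank M
      outer = defect (λ X → r (Z ∪ X))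
      inner = defect (λ X → r (C ∩ X))

    minorDefect : Subset n → ℕ
    minorDefect X = r Z ∸ r (C ∪ (Z ∩ ∁ X))

    outer-superadditive : ∀ Xs → AllPairs Disjoint Xs → sum (map outer Xs) + r Z ≤ r ⊤
    outer-superadditive Xs Xs# = begin
      sum (map outer Xs) + r Z        ≤⟨ +-monoʳ-≤ _ (rank-mono M (p⊆p∪q _)) ⟩
      sum (map outer Xs) + r (Z ∪ _)
        ≤⟨ defect-superadditive (λ X → r (Z ∪ X)) (rank-mono M ∘ ∪-mono id) submod Xs Xs# ⟩
      r (Z ∪ ⊤)                       ≤⟨ rank-mono M ⊆⊤ ⟩
      r ⊤                             ∎
      where
      open ≤-Reasoning
      submod : ∀ X Y → r (Z ∪ (X ∪ Y)) + r (Z ∪ (X ∩ Y)) ≤ r (Z ∪ X) + r (Z ∪ Y)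
      submod X Y = rank-submod-⊆ M (Z ∪ X) (Z ∪ Y)
        (∪-⊆ (p⊆p∪q _ ∘ p⊆p∪q X) (∪-mono (q⊆p∪q Z X) (q⊆p∪q Z Y)))
        (∩-greatest (∪-mono id (p∩q⊆p X Y)) (∪-mono id (p∩q⊆q X Y)))

    inner-superadditive : ∀ Xs → AllPairs Disjoint Xs → sum (map inner Xs) ≤ r C
    inner-superadditive Xs Xs# = begin
      sum (map inner Xs)              ≤⟨ m≤m+n _ _ ⟩
      sum (map inner Xs) + r (C ∩ _)
        ≤⟨ defect-superadditive (λ X → r (C ∩ X)) (rank-mono M ∘ ∩-monoʳ) submod Xs Xs# ⟩
      r (C ∩ ⊤)                       ≤⟨ rank-mono M (p∩q⊆p C ⊤) ⟩
      r C                             ∎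
      where
      open ≤-Reasoning
      ∩-monoʳ : ∀ {X Y} → X ⊆ Y → C ∩ X ⊆ C ∩ Y
      ∩-monoʳ X⊆Y = ∩-greatest (p∩q⊆p C _) (X⊆Y ∘ p∩q⊆q C _)
      distrib : ∀ X Y → C ∩ (X ∪ Y) ⊆ (C ∩ X) ∪ (C ∩ Y)
      distrib X Y e∈ with e∈C , e∈X∪Y ← x∈p∩q⁻ C (X ∪ Y) e∈ =
        x∈p∪q⁺ (⊎-map (λ e∈X → x∈p∩q⁺ (e∈C , e∈X)) (λ e∈Y → x∈p∩q⁺ (e∈C , e∈Y)) (x∈p∪q⁻ X Y e∈X∪Y))
      submod : ∀ X Y → r (C ∩ (X ∪ Y)) + r (C ∩ (X ∩ Y)) ≤ r (C ∩ X) + r (C ∩ Y)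
      submod X Y = rank-submod-⊆ M (C ∩ X) (C ∩ Y) (distrib X Y)
        (∩-greatest (∩-monoʳ (p∩q⊆p X Y)) (∩-monoʳ (p∩q⊆q X Y)))

    -- Submodularity is used on `Z` and `∁ X`, and on `C` and `Z ∩ ∁ X`; in the sum the rank of
    -- `Z ∩ ∁ X` cancels.
    defect-≤ : ∀ X → defect r X ≤ outer X + inner X + minorDefect X
    defect-≤ X = m≤n+o⇒m∸n≤o (r ⊤) (r (∁ X)) (begin
      r ⊤                                   ≤⟨ m≤n+m∸n (r ⊤) r₁ ⟩
      r₁ + (r ⊤ ∸ r₁)                       ≤⟨ +-mono-≤ r₁≤ (∸-monoˡ-≤ r₁ (rank-mono M (q⊆p∪q Z ⊤))) ⟩
      d + c + r (∁ X) + outer X             ≡⟨ shuffle d c (r (∁ X)) (outer X) ⟩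
      r (∁ X) + (outer X + c + d)
        ≤⟨ +-monoʳ-≤ (r (∁ X)) (+-monoˡ-≤ d (+-monoʳ-≤ (outer X)
             (∸-monoˡ-≤ r₃ (rank-mono M (∩-greatest id (λ _ → ∈⊤)))))) ⟩
      r (∁ X) + (outer X + inner X + d)     ∎)
      where
      open ≤-Reasoning
      r₁ = r (Z ∪ ∁ X)
      r₂ = r (C ∪ (Z ∩ ∁ X))
      r₃ = r (C ∩ ∁ X)
      rI = r (Z ∩ ∁ X)
      c  = r C ∸ r₃
      d  = minorDefect X
      shuffle : ∀ d c x o → d + c + x + o ≡ x + (o + c + d)
      shuffle = solve-∀
      shuffle₂ : ∀ i d c x → d + (c + i) + x ≡ i + (d + c + x)
      shuffle₂ = solve-∀
      r₂≤ : r₂ ≤ c + rI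
      r₂≤ = +-cancelʳ-≤ r₃ _ _ (begin
        r₂ + r₃        ≤⟨ rank-submod-⊆ M C (Z ∩ ∁ X) id
                            (∩-greatest (p∩q⊆p C _) (∩-greatest (C⊆Z ∘ p∩q⊆p C _) (p∩q⊆q C _))) ⟩
        r C + rI       ≡⟨ cong (_+ rI) (m∸n+n≡m (rank-mono M (p∩q⊆p C (∁ X)))) ⟨
        c + r₃ + rI    ≡⟨ +-assoc c r₃ rI ⟩
        c + (r₃ + rI)  ≡⟨ cong (c +_) (+-comm r₃ rI) ⟩
        c + (rI + r₃)  ≡⟨ +-assoc c rI r₃ ⟨
        c + rI + r₃    ∎)
      r₁≤ : r₁ ≤ d + c + r (∁ X)
      r₁≤ = +-cancelˡ-≤ rI _ _ (begin
        rI + r₁                  ≡⟨ +-comm rI r₁ ⟩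
        r₁ + rI                  ≤⟨ rank-submod M Z (∁ X) ⟩
        r Z + r (∁ X)            ≡⟨ cong (_+ r (∁ X)) (m∸n+n≡m (rank-mono M (∪-⊆ C⊆Z (p∩q⊆p Z (∁ X))))) ⟨
        d + r₂ + r (∁ X)         ≤⟨ +-monoˡ-≤ (r (∁ X)) (+-monoʳ-≤ d r₂≤) ⟩
        d + (c + rI) + r (∁ X)   ≡⟨ shuffle₂ rI d c (r (∁ X)) ⟩
        rI + (d + c + r (∁ X))   ∎)

    sum-defect-≤ : ∀ {Xs} → All (λ X → r Z ≤ r (C ∪ (Z ∩ ∁ X))) Xs →
                   sum (map (defect r) Xs) ≤ sum (map outer Xs) + sum (map inner Xs)
    sum-defect-≤ []                    = z≤n
    sum-defect-≤ {X ∷ Xs} (full ∷ fulls) = begin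
      defect r X + sum (map (defect r) Xs)   ≤⟨ +-mono-≤ (defect-≤ X) (sum-defect-≤ fulls) ⟩
      outer X + inner X + minorDefect X + (O + I)
        ≡⟨ cong (λ d → outer X + inner X + d + (O + I)) (m≤n⇒m∸n≡0 full) ⟩
      outer X + inner X + 0 + (O + I)        ≡⟨ shuffle (outer X) (inner X) O I ⟩
      (outer X + O) + (inner X + I)          ∎
      where
      open ≤-Reasoning
      O = sum (map outer Xs)
      I = sum (map inner Xs)
      shuffle : ∀ a b c d → a + b + 0 + (c + d) ≡ (a + c) + (b + d)
      shuffle = solve-∀

    -- `X` is one branch at a node and `Xs` are the others, whose defects vanish in the minor. When
    -- every defect in the width bound is expanded, the outer parts sum to at most r(E) - r(Z) and
    -- the inner parts to at most r(C). What remains is r(Z) minus the defect of `X` in the minor,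
    -- which is the rank to be bounded.
    rank-cell-≤ : ∀ {k} X Xs → r ⊤ ∸ (sum (map (defect r) Xs) + defect r X) ≤ k →
      AllPairs Disjoint (X ∷ Xs) → All (λ Y → r Z ≤ r (C ∪ (Z ∩ ∁ Y))) Xs →
      r (C ∪ (Z ∩ ∁ X)) ≤ k + r C
    rank-cell-≤ {k} X Xs width X∷Xs# fulls = +-cancelˡ-≤ (r ⊤ + r Z) _ _ (begin
      r ⊤ + r Z + r′                                   ≤⟨ +-monoˡ-≤ r′ (+-monoˡ-≤ (r Z) (m∸n≤o⇒m≤n+o′ width)) ⟩
      sum (map (defect r) Xs) + defect r X + k + r Z + r′
        ≤⟨ +-monoˡ-≤ r′ (+-monoˡ-≤ (r Z) (+-monoˡ-≤ k (+-mono-≤ (sum-defect-≤ fulls) (defect-≤ X)))) ⟩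
      O + I + (o + i + d) + k + r Z + r′               ≡⟨ shuffle O I o i d k (r Z) r′ ⟩
      (o + O + r Z) + (d + r′) + (k + (i + I))
        ≤⟨ +-mono-≤ (+-mono-≤ (outer-superadditive (X ∷ Xs) X∷Xs#)
                               (≤-reflexive (m∸n+n≡m (rank-mono M (∪-⊆ C⊆Z (p∩q⊆p Z (∁ X)))))))
                    (+-monoʳ-≤ k (inner-superadditive (X ∷ Xs) X∷Xs#)) ⟩
      r ⊤ + r Z + (k + r C)                            ∎)
      where
      open ≤-Reasoning
      r′ = r (C ∪ (Z ∩ ∁ X))
      O = sum (map outer Xs)
      I = sum (map inner Xs)
      o = outer X
      i = inner X
      d = minorDefect X
      m∸n≤o⇒m≤n+o′ : ∀ {m n o} → m ∸ n ≤ o → m ≤ n + o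
      m∸n≤o⇒m≤n+o′ {m} {n} m∸n≤o = ≤-trans (m≤n+m∸n m n) (+-monoʳ-≤ n m∸n≤o)
      shuffle : ∀ O I o i d k z r → O + I + (o + i + d) + k + z + r ≡ (o + O + z) + (d + r) + (k + (i + I))
      shuffle = solve-∀

  -- Branches of a tree-decomposition.

  module _ {n} {M : Matroid n} (D : TreeDecomposition M) where
    open TreeDecomposition D

    -- `inSubtree` without fuel: `u` lies on the path from the given vertex to the root, and proofs
    -- go by induction along that path.
    data Ancestor (u : Fin (suc t)) : Fin (suc t) → Set where
      self : Ancestor u u
      up   : ∀ {i} → Ancestor u (parent i) → Ancestor u (suc i)

    ancestor-≤ : ∀ {u w} → Ancestor u w → toℕ u ≤ toℕ w
    ancestor-≤ self       = ≤-refl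
    ancestor-≤ (up {i} a) = m≤n⇒m≤1+n (≤-trans (ancestor-≤ a) (parent-lt i))

    ancestor-linear : ∀ {u u′ w} → Ancestor u w → Ancestor u′ w → Ancestor u u′ ⊎ Ancestor u′ u
    ancestor-linear self   a′      = inj₂ a′
    ancestor-linear a      self    = inj₁ a
    ancestor-linear (up a) (up a′) = ancestor-linear a a′

    root-ancestor : ∀ k w → toℕ w ≤ k → Ancestor zero w
    root-ancestor k       zero    _         = self
    root-ancestor (suc k) (suc i) (s≤s i≤k) = up (root-ancestor k (parent i) (≤-trans (parent-lt i) i≤k))

    parent-ancestor : ∀ {i w} → Ancestor (suc i) w → Ancestor (parent i) w
    parent-ancestor self   = up self
    parent-ancestor (up a) = up (parent-ancestor a)

    -- A proper ancestor of `suc j` is an ancestor of the common parent, so its index is at most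
    -- that of the parent, which is below `suc i`.
    siblings-comparable : ∀ {i j} → parent i ≡ parent j → Ancestor (suc i) (suc j) → i ≡ j
    siblings-comparable _ self = refl
    siblings-comparable {i} {j} pi≡pj (up a) = contradiction
      (≤-trans (ancestor-≤ a) (≤-trans (≤-reflexive (cong toℕ (sym pi≡pj))) (parent-lt i))) (<-irrefl refl)

    -- The ancestors of one vertex form a chain, so two siblings above it are comparable.
    siblings-disjoint : ∀ {i j w} → parent i ≡ parent j → Ancestor (suc i) w → Ancestor (suc j) w → i ≡ j
    siblings-disjoint pi≡pj a a′ with ancestor-linear a a′
    ... | inj₁ b = siblings-comparable pi≡pj b
    ... | inj₂ b = sym (siblings-comparable (sym pi≡pj) b)

    inSubtree⇒ancestor : ∀ k {u w} → T (inSubtree k u w) → Ancestor u w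
    inSubtree⇒ancestor zero {u} {w} p with refl ← toWitness p = self
    inSubtree⇒ancestor (suc k) {u} {zero}  p with refl ← toWitness p = self
    inSubtree⇒ancestor (suc k) {u} {suc i} p with Equivalence.to (T-∨ {⌊ u Fin.≟ suc i ⌋}) p
    ... | inj₁ u≡w with refl ← toWitness u≡w = self
    ... | inj₂ q = up (inSubtree⇒ancestor k q)

    ancestor⇒inSubtree : ∀ k {u w} → toℕ w ≤ k → Ancestor u w → T (inSubtree k u w)
    ancestor⇒inSubtree zero    {w = zero}  _         self   = fromWitness {a? = zero {t} Fin.≟ zero} refl
    ancestor⇒inSubtree (suc k) {w = zero}  _         self   = fromWitness {a? = zero {t} Fin.≟ zero} refl
    ancestor⇒inSubtree (suc k) {w = suc i} _         self   =
      Equivalence.from (T-∨ {⌊ suc i Fin.≟ suc i ⌋}) (inj₁ (fromWitness {a? = suc i Fin.≟ suc i} refl))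
    ancestor⇒inSubtree (suc k) {u} {suc i} (s≤s i≤k) (up a) = Equivalence.from (T-∨ {⌊ u Fin.≟ suc i ⌋})
      (inj₂ (ancestor⇒inSubtree k (≤-trans (parent-lt i) i≤k) a))

    ∈B⁻ : ∀ {u e} → e ∈ B u → Ancestor u (τ e)
    ∈B⁻ e∈ = inSubtree⇒ancestor (suc t) (∈-tabulate⁻ e∈)

    ∈B⁺ : ∀ {u e} → Ancestor u (τ e) → e ∈ B u
    ∈B⁺ {e = e} a = ∈-tabulate⁺ (ancestor⇒inSubtree (suc t) (<⇒≤ (Fin.toℕ<n (τ e))) a)

    children : Fin (suc t) → List (Fin t)
    children v = filter (λ i → parent i Fin.≟ v) (allFin t)

    branches-disjoint : ∀ v → AllPairs Disjoint (∁ (B v) ∷ map (B ∘ suc) (children v))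
    branches-disjoint v =
      All.map⁺ (All.map (λ { refl e∈∁Bv e∈Bi → x∈∁p⇒x∉p e∈∁Bv (∈B⁺ (parent-ancestor (∈B⁻ e∈Bi))) }) parent≡v)
      ∷ AllPairs.map⁺ (AllPairs-with-All {R = _≢_} {S = Disjoint on (B ∘ suc)}
          (λ pi≡v pj≡v i≢j {e} e∈Bi e∈Bj → i≢j (siblings-disjoint (trans pi≡v (sym pj≡v)) (∈B⁻ e∈Bi) (∈B⁻ e∈Bj)))
          parent≡v
          (AllPairs.filter⁺ (λ i → parent i Fin.≟ v) (AllPairs.tabulate⁺ id)))
      where
      parent≡v : All (λ i → parent i ≡ v) (children v)
      parent≡v = All.all-filter (λ i → parent i Fin.≟ v) (allFin t)

    -- Children have larger indices than their parent, so the last node v whose branch has positive rank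
    -- defect in the minor has only children of rank defect 0, and the width of v bounds the rank of B v.
    thin-cell : ∀ {k C Z} → (∀ v → nodeWidth v ≤ k) → C ⊆ Z → rank M C < rank M Z →
                ∃ λ P → rank M (C ∪ (Z ∩ P)) ≤ k + rank M C × rank M (C ∪ (Z ∩ ∁ P)) < rank M Z
    thin-cell {k} {C} {Z} width C⊆Z rC<rZ
      -- The root qualifies, so a last node exists: `B zero` contains every element, hence only `C`
      -- is left, and its rank is below that of `Z`.
      with v , cut , later ← last-satisfying (λ v → suc (rank M (C ∪ (Z ∩ ∁ (B v)))) ≤? rank M Z)
             (zero , ≤-trans (s≤s (rank-mono M (∪-⊆ id λ e∈ →
               ⊥-elim (x∈∁p⇒x∉p (p∩q⊆q Z _ e∈) (∈B⁺ (root-ancestor _ _ ≤-refl)))))) rC<rZ) =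
      B v , ≤-trans (rank-mono M (∪-mono id (∩-greatest (p∩q⊆p Z (B v)) (x∉p⇒x∈∁p ∘ x∈p⇒x∉∁p ∘ p∩q⊆q Z (B v)))))
                    (rank-cell-≤ M C⊆Z (∁ (B v)) (map (B ∘ suc) (children v)) width′ (branches-disjoint v) full) , cut
      where
      width′ : rank M ⊤ ∸ (sum (map (defect (rank M)) (map (B ∘ suc) (children v))) + defect (rank M) (∁ (B v))) ≤ k
      width′ = subst (λ ds → rank M ⊤ ∸ (sum ds + defect (rank M) (∁ (B v))) ≤ k) (map-∘ (children v)) (width v)
      full : All (λ X → rank M Z ≤ rank M (C ∪ (Z ∩ ∁ X))) (map (B ∘ suc) (children v))
      full = All.map⁺ (All.map (λ { {i} refl → ≮⇒≥ (later (suc i) (s≤s (parent-lt i))) })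
               (All.all-filter (λ i → parent i Fin.≟ v) (allFin t)))

open Minors

span-⊹ : ∀ {n} {C : Subset n} L e → span (C ⊹ e) L ≡ span C L ⊹ e
span-⊹         []      e = ≡.refl
span-⊹ {C = C} (f ∷ L) e = ≡.trans (≡.cong (λ X → span X L) (⊹-comm C e f)) (span-⊹ L e)

span-↭ : ∀ {n} {C : Subset n} {L L′} → L ↭ L′ → span C L ≡ span C L′
span-↭ {C = C} {L} {L′} L↭L′ = ⊆-antisym (span-mono C L L′ (∈-resp-↭ L↭L′)) (span-mono C L′ L (∈-resp-↭ (↭-sym L↭L′)))

-- Order arithmetic in the field.

module OrderedFieldProperties {c ℓ₁ ℓ₂} (F : OrderedField c ℓ₁ ℓ₂) where
  open OrderedField F hiding (zero)
  open IsStrictTotalOrder isStrictTotalOrder public using (compare; <-respˡ-≈; <-respʳ-≈)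
    renaming (irrefl to <-irrefl; trans to <-trans)
  open StrictToNonStrict _≈_ _<_ public using (_≤_; <⇒≤)
  open RingProperties ring
  open CommutativeSemigroupProperties +-commutativeSemigroup using (interchange)
  open ≈-Reasoning setoid

  private
    module ≤ = StrictToNonStrict _≈_ _<_
    <-resp-≈ = IsStrictTotalOrder.<-resp-≈ isStrictTotalOrder

  ≤-trans : ∀ {x y z} → x ≤ y → y ≤ z → x ≤ z
  ≤-trans = ≤.trans isEquivalence <-resp-≈ <-trans

  <-≤-trans : ∀ {x y z} → x < y → y ≤ z → x < z
  <-≤-trans = ≤.<-≤-trans <-trans <-respʳ-≈

  ≤-<-trans : ∀ {x y z} → x ≤ y → y < z → x < z
  ≤-<-trans = ≤.≤-<-trans sym <-trans <-respˡ-≈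

  ≤-reflexive : ∀ {x y} → x ≈ y → x ≤ y
  ≤-reflexive = inj₂

  +-monoˡ-≤ : ∀ {x y} z → x ≤ y → x + z ≤ y + z
  +-monoˡ-≤ z (inj₁ x<y) = inj₁ (+-monoˡ-< z x<y)
  +-monoˡ-≤ z (inj₂ x≈y) = inj₂ (+-congʳ x≈y)

  +-monoʳ-≤ : ∀ {x y} z → x ≤ y → z + x ≤ z + y
  +-monoʳ-≤ z x≤y = ≤-trans (≤-reflexive (+-comm z _)) (≤-trans (+-monoˡ-≤ z x≤y) (≤-reflexive (+-comm _ z)))

  x-y+y≈x : ∀ x y → (x - y) + y ≈ x
  x-y+y≈x x y = trans (+-assoc x (- y) y) (trans (+-congˡ (-‿inverseˡ y)) (+-identityʳ x))

  x<y⇒0<y-x : ∀ {x y} → x < y → 0# < y - x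
  x<y⇒0<y-x {x} x<y = <-respˡ-≈ (-‿inverseʳ x) (+-monoˡ-< (- x) x<y)

  0<y-x⇒x<y : ∀ {x y} → 0# < y - x → x < y
  0<y-x⇒x<y {x} {y} 0<y-x =
    <-respˡ-≈ (+-identityˡ x) (<-respʳ-≈ (x-y+y≈x y x) (+-monoˡ-< x 0<y-x))

  x-y≤x : ∀ {x y} → 0# ≤ y → x - y ≤ x
  x-y≤x {x} {y} 0≤y = ≤-trans (≤-reflexive (sym (+-identityʳ (x - y))))
    (≤-trans (+-monoʳ-≤ (x - y) 0≤y) (≤-reflexive (x-y+y≈x x y)))

  y<x+y⇒0<x : ∀ {x y} → y < x + y → 0# < x
  y<x+y⇒0<x {x} {y} y<x+y = <-respˡ-≈ (-‿inverseʳ y)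
    (<-respʳ-≈ (trans (+-assoc x y (- y)) (trans (+-congˡ (-‿inverseʳ y)) (+-identityʳ x))) (+-monoˡ-< (- y) y<x+y))

  *-monoˡ-< : ∀ {x y z} → 0# < z → x < y → x * z < y * z
  *-monoˡ-< {x} {y} {z} 0<z x<y =
    0<y-x⇒x<y (<-respʳ-≈ ([y-z]x≈yx-zx z y x) (*-pos (x<y⇒0<y-x x<y) 0<z))

  *-cancelˡ-< : ∀ {x y z} → 0# < z → z * x < z * y → x < y
  *-cancelˡ-< {x} {y} {z} 0<z zx<zy with compare x y
  ... | tri< x<y _ _ = x<y
  ... | tri≈ _ x≈y _ = contradiction zx<zy (<-irrefl (*-congˡ x≈y))
  ... | tri> _ _ y<x = contradiction
    (<-trans zx<zy (<-respˡ-≈ (*-comm y z) (<-respʳ-≈ (*-comm x z) (*-monoˡ-< 0<z y<x)))) (<-irrefl refl)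

  0<1 : 0# < 1#
  0<1 with compare 0# 1#
  ... | tri< 0<1 _ _ = 0<1
  ... | tri≈ _ 0≈1 _ = contradiction 0≈1 0≉1
  ... | tri> _ _ 1<0 = <-respʳ-≈ -1*-1≈1 (*-pos 0<-1 0<-1)
    where
    0<-1 : 0# < - 1#
    0<-1 = <-respʳ-≈ (+-identityˡ (- 1#)) (x<y⇒0<y-x 1<0)
    -1*-1≈1 : - 1# * - 1# ≈ 1#
    -1*-1≈1 = trans (-1*x≈-x (- 1#)) (-‿involutive 1#)

  fromℕ-nonneg : ∀ m → 0# ≤ fromℕ F m
  fromℕ-nonneg zero    = ≤-reflexive refl
  fromℕ-nonneg (suc m) = ≤-trans (fromℕ-nonneg m)
    (≤-trans (≤-reflexive (sym (+-identityˡ _))) (+-monoˡ-≤ _ (<⇒≤ 0<1)))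

  fromℕ-mono : ∀ {m n} → m ℕ.≤ n → fromℕ F m ≤ fromℕ F n
  fromℕ-mono {n = n} ℕ.z≤n = fromℕ-nonneg n
  fromℕ-mono (ℕ.s≤s m≤n)   = +-monoʳ-≤ 1# (fromℕ-mono m≤n)

  fromℕ-+ : ∀ m n → fromℕ F (m ℕ.+ n) ≈ fromℕ F m + fromℕ F n
  fromℕ-+ zero    n = sym (+-identityˡ _)
  fromℕ-+ (suc m) n = trans (+-congˡ (fromℕ-+ m n)) (sym (+-assoc _ _ _))

  fromℕ-* : ∀ m n → fromℕ F (m ℕ.* n) ≈ fromℕ F m * fromℕ F n
  fromℕ-* zero    n = sym (zeroˡ _)
  fromℕ-* (suc m) n = begin
    fromℕ F (n ℕ.+ m ℕ.* n)                      ≈⟨ fromℕ-+ n (m ℕ.* n) ⟩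
    fromℕ F n + fromℕ F (m ℕ.* n)                ≈⟨ +-cong (sym (*-identityˡ _)) (fromℕ-* m n) ⟩
    1# * fromℕ F n + fromℕ F m * fromℕ F n       ≈⟨ distribʳ _ _ _ ⟨
    (1# + fromℕ F m) * fromℕ F n                 ∎

  x-0≈x : ∀ x → x - 0# ≈ x
  x-0≈x x = trans (+-congˡ -0#≈0#) (+-identityʳ x)

  [x-y]-[z-w]≈[x-z]-[y-w] : ∀ x y z w → (x - y) - (z - w) ≈ (x - z) - (y - w)
  [x-y]-[z-w]≈[x-z]-[y-w] x y z w = begin
    (x - y) + - (z - w)          ≈⟨ +-congˡ (-‿+-comm z (- w)) ⟨
    (x - y) + (- z + - - w)      ≈⟨ interchange x (- y) (- z) (- - w) ⟩
    (x - z) + (- y + - - w)      ≈⟨ +-congˡ (-‿+-comm y (- w)) ⟩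
    (x - z) - (y - w)            ∎

-- Whitney's expansion: loops, coloops, deletion and contraction.

module CharacteristicPolynomial {c ℓ₁ ℓ₂} (F : OrderedField c ℓ₁ ℓ₂) where
  open OrderedField F hiding (zero)
  open OrderedFieldProperties F
  open RingProperties ring
  open ≈-Reasoning setoid

  -- The sum of (-1)^|A| f(C ∪ A) over the sublists `A` of `L`.
  alternating : ∀ {n} → (Subset n → Carrier) → Subset n → List (Fin n) → Carrier
  alternating f C []      = f C
  alternating f C (e ∷ L) = alternating f C L - alternating f (C ⊹ e) L

  -- Every set reached lies between `C` and `U`, so `f ∘ h` and `g` are compared only there; the
  -- rank identities for a coloop are supplied only in that range. In the uses below `h` is the
  -- identity or adjoins a fixed element.
  alternating-map : ∀ {n} {f g : Subset n → Carrier} {h : Subset n → Subset n} {C U} →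
    (∀ A e → h (A ⊹ e) ≡ h A ⊹ e) → ∀ L → C ⊆ U → All (_∈ U) L →
    (∀ A → C ⊆ A → A ⊆ U → f (h A) ≈ g A) → alternating f (h C) L ≈ alternating g C L
  alternating-map {C = C} h-⊹ []      C⊆U _           f≈g = f≈g C id C⊆U
  alternating-map {f = f} {C = C} h-⊹ (e ∷ L) C⊆U (e∈U ∷ L⊆U) f≈g = +-cong
    (alternating-map h-⊹ L C⊆U L⊆U f≈g)
    (-‿cong (trans (reflexive (≡.cong (λ X → alternating f X L) (≡.sym (h-⊹ C e))))
      (alternating-map h-⊹ L (⊹-⊆ C⊆U e∈U) L⊆U (λ A Ce⊆A → f≈g A (Ce⊆A ∘ ⊆-⊹)))))

  alternating-* : ∀ {n} {f : Subset n → Carrier} {C} a L →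
                  alternating (λ A → a * f A) C L ≈ a * alternating f C L
  alternating-* a []      = refl
  alternating-* a (e ∷ L) =
    trans (+-cong (alternating-* a L) (-‿cong (alternating-* a L))) (sym (x[y-z]≈xy-xz a _ _))

  alternating-↭ : ∀ {n} {f : Subset n → Carrier} {C L L′} → L ↭ L′ →
                  alternating f C L ≈ alternating f C L′
  alternating-↭ Perm.refl          = refl
  alternating-↭ (prep e p)         = +-cong (alternating-↭ p) (-‿cong (alternating-↭ p))
  alternating-↭ {f = f} {C} (swap {ys = L′} e e′ p) =
    trans ([x-y]-[z-w]≈[x-z]-[y-w] _ _ _ _)
      (+-cong (+-cong (alternating-↭ p) (-‿cong (alternating-↭ p)))
        (-‿cong (+-cong (alternating-↭ p) (-‿cong (trans (alternating-↭ p)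
          (reflexive (≡.cong (λ X → alternating f X L′) (⊹-comm C e e′))))))))
  alternating-↭ (Perm.trans p p′)  = trans (alternating-↭ p) (alternating-↭ p′)

  module _ {n} (M : Matroid n) (x : Carrier) where

    -- Whitney's rank expansion of the characteristic polynomial of the minor (M / C) | L.
    χ : Subset n → List (Fin n) → Carrier
    χ C L = alternating (λ A → pow F x (rank M (span C L) ∸ rank M A)) C L

    χ-↭ : ∀ {C L L′} → L ↭ L′ → χ C L ≈ χ C L′
    χ-↭ {C} {L} {L′} p = trans (alternating-↭ p)
      (reflexive (≡.cong (λ Z → alternating (λ A → pow F x (rank M Z ∸ rank M A)) C L′) (span-↭ p)))

    -- Sets with and without the loop have equal rank and opposite sign, so they cancel.
    χ-loop : ∀ {C L e} → e ∈ₗ L → ¬ Nonloop M C e → χ C L ≈ 0#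
    χ-loop {L = L} = vanishes (rank M (span _ L))
      where
      -- The top rank `k` is frozen: the recursion shortens the list, while the exponents still
      -- refer to the full one.
      vanishes : ∀ k {C L e} → e ∈ₗ L → ¬ Nonloop M C e →
                 alternating (λ A → pow F x (k ∸ rank M A)) C L ≈ 0#
      vanishes k {L = e ∷ L} (here ≡.refl) e∈clC = trans
        (+-congˡ (-‿cong (alternating-map (λ A f → ⊹-comm A f e) L ⊆⊤ (All.tabulate (λ _ → ∈⊤))
          (λ A C⊆A _ → reflexive (≡.cong (λ m → pow F x (k ∸ m)) (loop-rank M (loop-⊆ M C⊆A e∈clC)))))))
        (-‿inverseʳ _)
      vanishes k (there e∈L) e∈clC = trans
        (+-cong (vanishes k e∈L e∈clC) (-‿cong (vanishes k e∈L (loop-⊆ M ⊆-⊹ e∈clC))))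
        (-‿inverseʳ 0#)

    -- When deleting `e` keeps the rank, the sets avoiding `e` have the same exponents in both
    -- minors; the contraction term matches by definition.
    χ-delete-contract : ∀ {C e L} → rank M (span C (e ∷ L)) ≡ rank M (span C L) →
                        χ C (e ∷ L) ≈ χ C L - χ (C ⊹ e) L
    χ-delete-contract {C} {e} {L} same =
      +-congʳ (reflexive (≡.cong (λ k → alternating (λ A → pow F x (k ∸ rank M A)) C L) same))

    module _ {C L e} (e∉clL : Nonloop M (span C L) e) where

      rank-span-coloop : rank M (span C (e ∷ L)) ≡ suc (rank M (span C L))
      rank-span-coloop = ≡.trans (≡.cong (rank M) (span-⊹ L e)) (nonloop-rank M e∉clL)

      -- Adjoining a coloop raises the top rank and the rank of every set by one, so no exponent
      -- changes.
      χ-contract-coloop : χ (C ⊹ e) L ≈ χ C L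
      χ-contract-coloop = alternating-map (λ A f → ⊹-comm A f e) L (⊆-span L) (All-∈-span L)
        (λ A _ A⊆ → reflexive (≡.cong₂ (λ m k → pow F x (m ∸ k)) rank-span-coloop
                      (nonloop-rank M (nonloop-⊆ M A⊆ e∉clL))))

      -- Sets avoiding `e` have an exponent one larger than in the deletion, whence the factor `x`;
      -- sets containing it give the contraction, which equals the deletion.
      χ-coloop : χ C (e ∷ L) ≈ x * χ C L - χ C L
      χ-coloop = +-cong
        (trans (alternating-map {h = id} (λ _ _ → ≡.refl) L (⊆-span L) (All-∈-span L)
          (λ A _ A⊆ → reflexive (≡.cong (pow F x) (≡.trans (≡.cong (_∸ rank M A) rank-span-coloop)
                        (ℕ.+-∸-assoc 1 (rank-mono M A⊆))))))
          (alternating-* x L))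
        (-‿cong χ-contract-coloop)

-- Hyperplanes and their complementary cocircuits.

module _ {n} (M : Matroid n) {C : Subset n} {m : ℕ} where

  -- H is the intersection with the minor of a hyperplane, and D of its complementary cocircuit.
  record Cocircuit (P Y : List (Fin n)) : Set where
    field
      D H       : List (Fin n)
      partition : P ++ Y ↭ D ++ H
      D⊆P       : ∀ {e} → e ∈ₗ D → e ∈ₗ P
      Y⊆H       : ∀ {e} → e ∈ₗ Y → e ∈ₗ H
      D-spans   : All (λ d → m ℕ.≤ rank M (span C (d ∷ H))) D
      H-proper  : rank M (span C H) ℕ.< m

  -- Greedy choice: an element of `P` joins `Y` unless it would bring the rank up to `m`. A rejected
  -- element reaches rank `m` with the current list, hence also with the final `H`, which contains
  -- that list.
  extend-to-hyperplane : ∀ P Y → rank M (span C Y) ℕ.< m → Cocircuit P Y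
  extend-to-hyperplane [] Y Y-proper = record
    { D = [] ; H = Y ; partition = Perm.refl ; D⊆P = id ; Y⊆H = id ; D-spans = [] ; H-proper = Y-proper }
  extend-to-hyperplane (p ∷ P) Y Y-proper with suc (rank M (span C (p ∷ Y))) ℕ.≤? m
  ... | yes pY-proper = record
    { D = D ; H = H ; partition = ↭-trans (↭-sym (shift p P Y)) partition
    ; D⊆P = there ∘ D⊆P ; Y⊆H = Y⊆H ∘ there ; D-spans = D-spans ; H-proper = H-proper }
    where open Cocircuit (extend-to-hyperplane P (p ∷ Y) pY-proper)
  ... | no  pY-spans = record
    { D = p ∷ D ; H = H ; partition = prep p partition
    ; D⊆P = λ { (here e≡p) → here e≡p ; (there e∈D) → there (D⊆P e∈D) } ; Y⊆H = Y⊆H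
    ; D-spans = ℕ.≤-trans (ℕ.≮⇒≥ pY-spans) (rank-span-mono M C (p ∷ Y) (p ∷ H)
        λ { (here e≡p) → here e≡p ; (there e∈Y) → there (Y⊆H e∈Y) }) ∷ D-spans
    ; H-proper = H-proper }
    where open Cocircuit (extend-to-hyperplane P Y Y-proper)

record ThinCocircuit {n} (M : Matroid n) (k : ℕ) (C : Subset n) (L : List (Fin n)) : Set where
  field
    d          : Fin n
    D H        : List (Fin n)
    U          : Subset n
    partition  : L ↭ d ∷ D ++ H
    D-spans    : All (λ e → rank M (span C L) ℕ.≤ rank M (span C (e ∷ H))) (d ∷ D)
    H-proper   : rank M (span C H) ℕ.< rank M (span C L)
    C⊆U        : C ⊆ U
    D⊆U        : All (_∈ U) (d ∷ D)
    rank-U     : rank M U ℕ.≤ k ℕ.+ rank M C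

-- The elements outside the thin cell `P` do not span the minor. A hyperplane containing them has
-- its complementary cocircuit inside the cell.
thin-cocircuit : ∀ {n k} {M : Matroid n} {C L} (T : TreeDecomposition M) →
                 (∀ v → TreeDecomposition.nodeWidth T v ℕ.≤ k) →
                 rank M C ℕ.< rank M (span C L) → ThinCocircuit M k C L
thin-cocircuit {k = k} {M} {C} {L} T width C<L = choose (thin-cell T width (⊆-span L) C<L)
  where
  Z = span C L
  choose : (∃ λ P → rank M (C ∪ (Z ∩ P)) ℕ.≤ k ℕ.+ rank M C × rank M (C ∪ (Z ∩ ∁ P)) ℕ.< rank M Z) →
           ThinCocircuit M k C L
  choose (P , cell≤ , cut) = nonempty (extend-to-hyperplane M inP outP (ℕ.≤-trans (ℕ.s≤s (rank-mono M
      (span-⊆ (p⊆p∪q _) (All.tabulate λ e∈ →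
        let e∈L , e∉P = ∈-filter⁻ (¬? ∘ (_∈? P)) {xs = L} e∈
        in q⊆p∪q C _ (x∈p∩q⁺ (∈-span {L = L} e∈L , x∉p⇒x∈∁p e∉P)))))) cut))
    where
    inP outP : List _
    inP  = filter (_∈? P) L
    outP = filter (¬? ∘ (_∈? P)) L
    nonempty : Cocircuit M {C} {rank M Z} inP outP → ThinCocircuit M k C L
    -- An empty cocircuit would put all of `L` into `H`, whose rank is too small.
    nonempty record { D = [] ; partition = p ; H-proper = H-proper } = contradiction
      (≡.subst (λ X → _ ℕ.< rank M X) (span-↭ (↭-trans (filter-↭ (_∈? P) L) p)) H-proper)
      (ℕ.<-irrefl ≡.refl)
    nonempty record { D = d ∷ D ; H = H ; partition = p ; D⊆P = D⊆P ; D-spans = D-spans ; H-proper = H-proper } = record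
      { d = d ; D = D ; H = H ; U = C ∪ (Z ∩ P)
      ; partition = ↭-trans (filter-↭ (_∈? P) L) p
      ; D-spans = D-spans ; H-proper = H-proper ; C⊆U = p⊆p∪q _
      ; D⊆U = All.tabulate λ e∈D →
          let e∈L , e∈P = ∈-filter⁻ (_∈? P) {xs = L} (D⊆P e∈D)
          in q⊆p∪q C _ (x∈p∩q⁺ (∈-span {L = L} e∈L , e∈P))
      ; rank-U = cell≤ }

-- The induction for positivity.

module Positivity {c ℓ₁ ℓ₂} (F : OrderedField c ℓ₁ ℓ₂) where
  open OrderedField F hiding (zero)
  open OrderedFieldProperties F
  open CharacteristicPolynomial F
  open RingProperties ring
  open ≈-Reasoning setoid

  module _ {n} (M : Matroid n) (x : Carrier) where

    private
      r = rank M
      W = χ M x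

    module _ {m} (nonneg : ∀ C L → length L ℕ.≤ m → 0# ≤ W C L) where

      -- While the rank does not drop, each deletion removes a contraction term from the formula,
      -- and that term is subtracted and nonnegative.
      χ-restrict-≤ : ∀ {C H} D → length (D ++ H) ℕ.≤ m → r (span C (D ++ H)) ℕ.≤ r (span C H) →
                     W C (D ++ H) ≤ W C H
      χ-restrict-≤         []      _      _    = ≤-reflexive refl
      χ-restrict-≤ {C} {H} (e ∷ D) len≤ full = ≤-trans (≤-reflexive (χ-delete-contract M x {e = e} {L = D ++ H}
          (ℕ.≤-antisym (ℕ.≤-trans full (rank-span-mono M C H (D ++ H) (∈-++⁺ʳ D)))
            (rank-span-mono M C (D ++ H) (e ∷ D ++ H) there))))
        (≤-trans (x-y≤x (nonneg (C ⊹ e) (D ++ H) (ℕ.<⇒≤ len≤)))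
          (χ-restrict-≤ D (ℕ.<⇒≤ len≤) (ℕ.≤-trans (rank-span-mono M C (D ++ H) (e ∷ D ++ H) there) full)))

      -- Deleting the elements of a cocircuit one by one, each contraction term is at most the value w
      -- on the hyperplane, and it vanishes when the element is parallel to one still present.
      χ-cocircuit-≥ : ∀ {C H Z} d D → r (span C H) ℕ.< r Z → span C (d ∷ D ++ H) ⊆ Z →
        All (λ e → r Z ℕ.≤ r (span C (e ∷ H))) (d ∷ D) → All (Nonloop M C) (d ∷ D) →
        length (D ++ H) ℕ.≤ m →
        ∃ λ R → (∀ {e} → e ∈ₗ R → e ∈ₗ d ∷ D) × AllPairs (Indep M C) R ×
          x * W C H ≤ W C (d ∷ D ++ H) + fromℕ F (length R) * W C H
      -- The last element is a coloop over `H`, so the value is (x - 1) w; the single class `d ∷ []`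
      -- accounts for the missing w.
      χ-cocircuit-≥ {C} {H} d [] H<Z _ (dH≥Z ∷ _) _ _ = d ∷ [] , id , [] ∷ [] , ≤-reflexive (begin
        x * w                           ≈⟨ x-y+y≈x (x * w) w ⟨
        (x * w - w) + w
          ≈⟨ +-cong (χ-coloop M x {L = H} d∉clH) (trans (*-congʳ (+-identityʳ 1#)) (*-identityˡ w)) ⟨
        W C (d ∷ H) + (1# + 0#) * w     ∎)
        where
        w = W C H
        d∉clH : Nonloop M (span C H) d
        d∉clH = ℕ.≤-trans (ℕ.≤-trans H<Z dH≥Z) (ℕ.≤-reflexive (≡.cong r (span-⊹ H d)))
      χ-cocircuit-≥ {C} {H} {Z} d (d′ ∷ D) H<Z ⊆Z (dH≥Z ∷ D≥Z) (d∉ ∷ D∉) len≤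
        with R , R⊆ , RR , xw≤ ← χ-cocircuit-≥ d′ D H<Z
               (⊆Z ∘ span-mono C (d′ ∷ D ++ H) (d ∷ d′ ∷ D ++ H) there) D≥Z D∉ (ℕ.<⇒≤ len≤) =
        add-d (All.all? (indep? M C d) (d′ ∷ D))
        where
        w = W C H
        K = d′ ∷ D ++ H
        d∉clH : Nonloop M (span C H) d
        d∉clH = ℕ.≤-trans (ℕ.≤-trans H<Z dH≥Z) (ℕ.≤-reflexive (≡.cong r (span-⊹ H d)))
        -- `d′` together with `H` already spans, so deleting `d` keeps the rank.
        K-spans : r Z ℕ.≤ r (span C K)
        K-spans = ℕ.≤-trans (All.head D≥Z) (rank-span-mono M C (d′ ∷ H) K
          λ { (here e≡d′) → here e≡d′ ; (there e∈H) → there (∈-++⁺ʳ D e∈H) })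
        delete-d : W C (d ∷ K) ≈ W C K - W (C ⊹ d) K
        delete-d = χ-delete-contract M x {L = K} (ℕ.≤-antisym
          (ℕ.≤-trans (rank-mono M ⊆Z) K-spans) (rank-span-mono M C K (d ∷ K) there))
        -- After `d` is contracted the rest of the cocircuit adds no rank to `H` and may be deleted.
        -- Over `H` alone `d` is a coloop, so its contraction leaves w unchanged.
        contracted≤w : W (C ⊹ d) K ≤ w
        contracted≤w = ≤-trans (χ-restrict-≤ (d′ ∷ D) len≤ (ℕ.≤-trans (rank-mono M ⊆Z) dH≥Z))
          (≤-reflexive (χ-contract-coloop M x {L = H} d∉clH))
        W≤ : W C K ≤ W C (d ∷ K) + w
        W≤ = ≤-trans (≤-reflexive (trans (sym (x-y+y≈x (W C K) (W (C ⊹ d) K))) (+-congʳ (sym delete-d))))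
          (+-monoʳ-≤ _ contracted≤w)
        regroup : ∀ y a → y + (1# + a) * w ≈ (y + w) + a * w
        regroup y a = trans (+-congˡ (trans (distribʳ w 1# a) (+-congʳ (*-identityˡ w)))) (sym (+-assoc y w _))
        add-d : Dec (All (Indep M C d) (d′ ∷ D)) →
                ∃ λ R′ → (∀ {e} → e ∈ₗ R′ → e ∈ₗ d ∷ d′ ∷ D) × AllPairs (Indep M C) R′ ×
                  x * w ≤ W C (d ∷ K) + fromℕ F (length R′) * w
        add-d (yes ind) = d ∷ R , (λ { (here e≡d) → here e≡d ; (there e∈R) → there (R⊆ e∈R) })
          , All.tabulate (All.lookup ind ∘ R⊆) ∷ RR
          , ≤-trans xw≤ (≤-trans (+-monoˡ-≤ _ W≤) (≤-reflexive (sym (regroup _ _))))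
        add-d (no ¬ind)
          with e , e∈D , parallel ← find (All.¬All⇒Any¬ (indep? M C d) (d′ ∷ D) ¬ind) =
          R , there ∘ R⊆ , RR , ≤-trans xw≤ (≤-reflexive (+-congʳ (sym
            (trans delete-d (trans (+-congˡ (-‿cong (χ-loop M x {L = K} (∈-++⁺ˡ e∈D) (¬indep⇒loop M d∉ parallel))))
              (x-0≈x (W C K)))))))

    module _ {q k} (T : TreeDecomposition M) (width : ∀ v → TreeDecomposition.nodeWidth T v ℕ.≤ k)
             (noLine : ¬ HasMinorIsoTo (uniformRank 2 {2 ℕ.+ q}) M)
             (large : fromℕ F (geometric q k) < x) where

      -- Mutual induction on the size bound: `χ-nonneg` falls back on `χ-pos` with the same `m`, and
      -- `χ-pos` uses both with a smaller one, nonnegativity for contractions and positivity for the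
      -- hyperplane.
      χ-pos    : ∀ m C L → length L ℕ.≤ m → All (Nonloop M C) L → 0# < W C L
      χ-nonneg : ∀ m C L → length L ℕ.≤ m → 0# ≤ W C L

      χ-nonneg m C L len≤ with All.all? (nonloop? M C) L
      ... | yes L∉ = <⇒≤ (χ-pos m C L len≤ L∉)
      ... | no ¬L∉ with e , e∈L , loop ← find (All.¬All⇒Any¬ (nonloop? M C) L ¬L∉) =
        ≤-reflexive (sym (χ-loop M x {L = L} e∈L loop))

      χ-pos m       C []         _    _ = <-respʳ-≈ (reflexive (≡.cong (pow F x) (≡.sym (ℕ.n∸n≡0 (r C))))) 0<1
      χ-pos (suc m) C (e ∷ L) (ℕ.s≤s len≤) L∉ = conclude
        (χ-cocircuit-≥ (χ-nonneg m) d D H-proper (≡.subst (_⊆ Z) (span-↭ partition) id) D-spans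
          (All.tabulate (All.lookup L∉ ∘ D⊆L)) DH≤m)
        where
        Z = span C (e ∷ L)
        cocircuit : ThinCocircuit M k C (e ∷ L)
        cocircuit = thin-cocircuit T width (ℕ.≤-trans (All.head L∉) (rank-mono M (⊆-span L)))
        open ThinCocircuit cocircuit
        w = W C H
        D⊆L : ∀ {f} → f ∈ₗ d ∷ D → f ∈ₗ e ∷ L
        D⊆L = ∈-resp-↭ (↭-sym partition) ∘ ∈-++⁺ˡ
        DH≤m : length (D ++ H) ℕ.≤ m
        DH≤m = ℕ.≤-trans (ℕ.≤-reflexive (≡.sym (ℕ.suc-injective (↭-length partition)))) len≤
        0<w : 0# < w
        0<w = χ-pos m C H
          (ℕ.≤-trans (ℕ.≤-trans (ℕ.m≤n+m (length H) (length D)) (ℕ.≤-reflexive (≡.sym (length-++ D)))) DH≤m)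
          (All.tabulate (All.lookup L∉ ∘ ∈-resp-↭ (↭-sym partition) ∘ there ∘ ∈-++⁺ʳ D))
        conclude : (∃ λ R → (∀ {f} → f ∈ₗ R → f ∈ₗ d ∷ D) × AllPairs (Indep M C) R ×
                     x * w ≤ W C (d ∷ D ++ H) + fromℕ F (length R) * w) → 0# < W C (e ∷ L)
        -- Since |R| < x and w is positive, |R| w < x w; cancelling |R| w from the cocircuit bound
        -- leaves a positive value.
        conclude (R , R⊆ , RR , xw≤) = <-respʳ-≈ (sym (χ-↭ M x partition)) (y<x+y⇒0<x
          (<-≤-trans (*-monoˡ-< 0<w (≤-<-trans (fromℕ-mono points) large)) xw≤))
          where
          points : length R ℕ.≤ geometric q k
          points = kung M noLine k R C⊆U (All.tabulate (All.lookup D⊆U ∘ R⊆)) rank-U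
            (All.tabulate (All.lookup L∉ ∘ D⊆L ∘ R⊆)) RR

-- Flats and closure.

_≟ₛ_ : ∀ {n} (X Y : Subset n) → Dec (X ≡ Y)
_≟ₛ_ = Vec.≡-dec Bool._≟_

∉⇒lookup : ∀ {n} {X : Subset n} {e} → e ∉ X → ¬ T (Vec.lookup X e)
∉⇒lookup {X = X} {e} e∉X e∈ = e∉X (Vec.lookup⇒[]= e X (Equivalence.to T-≡ e∈))

⊂ᵇ⇒⊆ : ∀ {n} {X Y : Subset n} → T (X ⊂ᵇ Y) → X ⊆ Y
⊂ᵇ⇒⊆ {n} {X} {Y} X⊂Y {e} e∈X
  with Equivalence.to (T-∨ {not (Vec.lookup X e)})
         (All.lookup (All.all⁺ (λ e → not (Vec.lookup X e) ∨ Vec.lookup Y e) (allFin n)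
           (proj₁ (Equivalence.to (T-∧ {X ⊆ᵇ Y}) X⊂Y))) (∈-allFin e))
... | inj₁ e∉X = contradiction (≡.trans (≡.sym (Vec.[]=⇒lookup e∈X)) (Equivalence.to T-not-≡ e∉X)) λ ()
... | inj₂ e∈Y = Vec.lookup⇒[]= e Y (Equivalence.to T-≡ e∈Y)

⊂ᵇ⇒∣∣< : ∀ {n} {X Y : Subset n} → T (X ⊂ᵇ Y) → ∣ X ∣ ℕ.< ∣ Y ∣
⊂ᵇ⇒∣∣< {X = X} {Y} X⊂Y = ℕ.<ᵇ⇒< _ _ (proj₂ (Equivalence.to (T-∧ {X ⊆ᵇ Y}) X⊂Y))

⊆∧≢⇒⊂ᵇ : ∀ {n} {X Y : Subset n} → X ⊆ Y → X ≢ Y → T (X ⊂ᵇ Y)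
⊆∧≢⇒⊂ᵇ {n} {X} {Y} X⊆Y X≢Y = Equivalence.from (T-∧ {X ⊆ᵇ Y})
  ( All.all⁻ (λ e → not (Vec.lookup X e) ∨ Vec.lookup Y e) (All.tabulate {xs = allFin n} (λ {e} _ → included e))
  , ℕ.<⇒<ᵇ (p⊂q⇒∣p∣<∣q∣ X⊂Y))
  where
  included : ∀ e → T (not (Vec.lookup X e) ∨ Vec.lookup Y e)
  included e with Vec.lookup X e in eq
  ... | false = _
  ... | true  = Equivalence.from T-≡ (Vec.[]=⇒lookup (X⊆Y (Vec.lookup⇒[]= e X eq)))
  X⊂Y : X ⊂ Y
  X⊂Y = decidable-stable (X ⊂? Y) λ X⊄Y → X≢Y (⊆-antisym X⊆Y λ {e} e∈Y →
    decidable-stable (e ∈? X) λ e∉X → X⊄Y (X⊆Y , e , e∈Y , e∉X))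

module _ {n} (M : Matroid n) where

  IsFlat : Subset n → Set
  IsFlat F = ∀ e → e ∉ F → Nonloop M F e

  isFlat⇒ : ∀ {F} → isFlat? M F ≡ true → IsFlat F
  isFlat⇒ {F} flat e e∉F
    with Equivalence.to (T-∨ {Vec.lookup F e}) (All.lookup (All.all⁺
           (λ e → Vec.lookup F e ∨ (rank M F ℕ.<ᵇ rank M (F ∪ ⁅ e ⁆))) (allFin n)
           (Equivalence.from T-≡ flat)) (∈-allFin e))
  ... | inj₁ e∈F = contradiction e∈F (∉⇒lookup e∉F)
  ... | inj₂ rF< = ℕ.<ᵇ⇒< _ _ rF<

  isFlat⇐ : ∀ {F} → IsFlat F → isFlat? M F ≡ true
  isFlat⇐ {F} flat = Equivalence.to T-≡ (All.all⁻
    (λ e → Vec.lookup F e ∨ (rank M F ℕ.<ᵇ rank M (F ∪ ⁅ e ⁆))) (All.tabulate {xs = allFin n} (λ {e} _ → good e)))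
    where
    good : ∀ e → T (Vec.lookup F e ∨ (rank M F ℕ.<ᵇ rank M (F ∪ ⁅ e ⁆)))
    good e with e ∈? F
    ... | yes e∈F = Equivalence.from T-∨ (inj₁ (Equivalence.from T-≡ (Vec.[]=⇒lookup e∈F)))
    ... | no  e∉F = Equivalence.from (T-∨ {Vec.lookup F e}) (inj₂ (ℕ.<⇒<ᵇ (flat e e∉F)))

  closure : Subset n → Subset n
  closure A = Vec.tabulate (λ e → ⌊ ¬? (nonloop? M A e) ⌋)

  ∈-closure⁺ : ∀ {A e} → ¬ Nonloop M A e → e ∈ closure A
  ∈-closure⁺ {A} {e} loop = ∈-tabulate⁺ (fromWitness {a? = ¬? (nonloop? M A e)} loop)

  ∈-closure⁻ : ∀ {A e} → e ∈ closure A → ¬ Nonloop M A e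
  ∈-closure⁻ {A} {e} e∈ = toWitness {a? = ¬? (nonloop? M A e)} (∈-tabulate⁻ e∈)

  ⊆-closure : ∀ {A} → A ⊆ closure A
  ⊆-closure {A} e∈A = ∈-closure⁺ λ nonloop →
    ℕ.<-irrefl ≡.refl (ℕ.≤-trans nonloop (rank-mono M (⊹-⊆ id e∈A)))

  -- The elements of the closure are adjoined one at a time, and each stays a loop over the growing
  -- set.
  rank-closure : ∀ A → rank M (closure A) ≡ rank M A
  rank-closure A = ℕ.≤-antisym
    (ℕ.≤-trans (rank-mono M {Y = span A L} λ e∈ → ∈-span (∈-filter⁺ (_∈? closure A) (∈-allFin _) e∈))
      (ℕ.≤-reflexive (rank-span-loops M (All.map ∈-closure⁻ (All.all-filter (_∈? closure A) (allFin n))))))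
    (rank-mono M ⊆-closure)
    where
    L : List (Fin n)
    L = filter (_∈? closure A) (allFin n)

  closure-flat : ∀ A → IsFlat (closure A)
  closure-flat A e e∉ = ℕ.≤-trans
    (ℕ.s≤s (ℕ.≤-reflexive (rank-closure A)))
    (ℕ.≤-trans (decidable-stable (nonloop? M A e) (e∉ ∘ ∈-closure⁺)) (rank-mono M (⊹-mono ⊆-closure)))

  closure-⊆ : ∀ {A F} → IsFlat F → A ⊆ F → closure A ⊆ F
  closure-⊆ {F = F} flat A⊆F {e} e∈ = decidable-stable (e ∈? F) λ e∉F →
    ∈-closure⁻ e∈ (nonloop-⊆ M A⊆F (flat e e∉F))

-- Finite sums and signs of subsets.

module RingSums {c ℓ} (R : CommutativeRing c ℓ) where
  open CommutativeRing R hiding (zero)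
  open RingProperties ring
  open CommutativeSemigroupProperties +-commutativeSemigroup using (interchange)
  open ≈-Reasoning setoid

  private variable
    a p q : Level
    A B   : Set a
    P Q   : Set p

  -- The Iverson bracket: it turns filtered sums into sums over all subsets, which can then be
  -- exchanged.
  when : Dec P → Carrier → Carrier
  when d x = if does d then x else 0#

  when-yes : (d : Dec P) → P → ∀ {x} → when d x ≈ x
  when-yes (yes _) _ = refl
  when-yes (no ¬P) p = contradiction p ¬P

  when-no : (d : Dec P) → ¬ P → ∀ {x} → when d x ≈ 0#
  when-no (yes p) ¬P = contradiction p ¬P
  when-no (no _)  _  = refl

  when-cong : (d : Dec P) → ∀ {x y} → (P → x ≈ y) → when d x ≈ when d y
  when-cong (yes p) x≈y = x≈y p
  when-cong (no _)  _   = refl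

  when-⇔ : (d : Dec P) (d′ : Dec Q) → (P → Q) → (Q → P) → ∀ {x} → when d x ≈ when d′ x
  when-⇔ (yes p) d′ P⇒Q _   = sym (when-yes d′ (P⇒Q p))
  when-⇔ (no ¬P) d′ _   Q⇒P = sym (when-no d′ (¬P ∘ Q⇒P))

  when-comm : (d : Dec P) (d′ : Dec Q) → ∀ {x} → when d (when d′ x) ≈ when d′ (when d x)
  when-comm (yes _) d′      = refl
  when-comm (no _)  (yes _) = refl
  when-comm (no _)  (no _)  = refl

  when-0 : (d : Dec P) → when d 0# ≈ 0#
  when-0 (yes _) = refl
  when-0 (no _)  = refl

  when-+ : (d : Dec P) → ∀ {x y} → when d (x + y) ≈ when d x + when d y
  when-+ (yes _) = refl
  when-+ (no _)  = sym (+-identityˡ 0#)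

  when-*ʳ : (d : Dec P) → ∀ {x y} → when d (x * y) ≈ x * when d y
  when-*ʳ (yes _)     = refl
  when-*ʳ (no _) {x}  = sym (zeroʳ x)

  when-*ˡ : (d : Dec P) → ∀ {x y} → when d (x * y) ≈ when d x * y
  when-*ˡ (yes _)     = refl
  when-*ˡ (no _) {y = y} = sym (zeroˡ y)

  ∑ : List A → (A → Carrier) → Carrier
  ∑ []       f = 0#
  ∑ (x ∷ xs) f = f x + ∑ xs f

  ∑-cong : ∀ (xs : List A) {f g} → (∀ x → f x ≈ g x) → ∑ xs f ≈ ∑ xs g
  ∑-cong []       f≈g = refl
  ∑-cong (x ∷ xs) f≈g = +-cong (f≈g x) (∑-cong xs f≈g)

  ∑-0 : ∀ (xs : List A) → ∑ xs (λ _ → 0#) ≈ 0#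
  ∑-0 []       = refl
  ∑-0 (x ∷ xs) = trans (+-identityˡ _) (∑-0 xs)

  ∑-+ : ∀ (xs : List A) {f g} → ∑ xs (λ x → f x + g x) ≈ ∑ xs f + ∑ xs g
  ∑-+ []       = sym (+-identityˡ 0#)
  ∑-+ (x ∷ xs) = trans (+-congˡ (∑-+ xs)) (interchange _ _ _ _)

  ∑-neg : ∀ (xs : List A) {f} → ∑ xs (λ x → - f x) ≈ - ∑ xs f
  ∑-neg []       = sym -0#≈0#
  ∑-neg (x ∷ xs) = trans (+-congˡ (∑-neg xs)) (-‿+-comm _ _)

  ∑-*ʳ : ∀ (xs : List A) {f} y → ∑ xs f * y ≈ ∑ xs (λ x → f x * y)
  ∑-*ʳ []       y = zeroˡ y
  ∑-*ʳ (x ∷ xs) y = trans (distribʳ y _ _) (+-congˡ (∑-*ʳ xs y))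

  ∑-when : ∀ (xs : List A) (d : Dec P) {f} → when d (∑ xs f) ≈ ∑ xs (λ x → when d (f x))
  ∑-when xs (yes _) = refl
  ∑-when xs (no _)  = sym (∑-0 xs)

  ∑-swap : ∀ (xs : List A) (ys : List B) {f : A → B → Carrier} →
           ∑ xs (λ x → ∑ ys (f x)) ≈ ∑ ys (λ y → ∑ xs (λ x → f x y))
  ∑-swap []       ys = sym (∑-0 ys)
  ∑-swap (x ∷ xs) ys = trans (+-congˡ (∑-swap xs ys)) (sym (∑-+ ys))

  ∑-++ : ∀ (xs ys : List A) {f} → ∑ (xs ++ ys) f ≈ ∑ xs f + ∑ ys f
  ∑-++ []       ys = sym (+-identityˡ _)
  ∑-++ (x ∷ xs) ys = trans (+-congˡ (∑-++ xs ys)) (sym (+-assoc _ _ _))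

  ∑-map : ∀ (h : A → B) (xs : List A) {f} → ∑ (map h xs) f ≈ ∑ xs (f ∘ h)
  ∑-map h []       = refl
  ∑-map h (x ∷ xs) = +-congˡ (∑-map h xs)

  ∑-filter : ∀ {P : A → Set p} (P? : Decidable P) xs {f} → ∑ (filter P? xs) f ≈ ∑ xs (λ x → when (P? x) (f x))
  ∑-filter P? []       = refl
  ∑-filter P? (x ∷ xs) with does (P? x)
  ... | true  = +-congˡ (∑-filter P? xs)
  ... | false = trans (∑-filter P? xs) (sym (+-identityˡ _))

  ∑-subsets : ∀ {n} (f : Subset (suc n) → Carrier) →
    ∑ (allSubsets (suc n)) f ≈ ∑ (allSubsets n) (λ A → f (outside ∷ A)) + ∑ (allSubsets n) (λ A → f (inside ∷ A))
  ∑-subsets {n} f = trans (∑-++ (map (outside ∷_) (allSubsets n)) _)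
    (+-cong (∑-map (outside ∷_) (allSubsets n)) (∑-map (inside ∷_) (allSubsets n)))

  ∑-≟ : ∀ {n} (X : Subset n) (f : Subset n → Carrier) → ∑ (allSubsets n) (λ A → when (X ≟ₛ A) (f A)) ≈ f X
  ∑-≟ []            f = +-identityʳ _
  ∑-≟ {suc n} (outside ∷ X) f = trans (∑-subsets (λ A → when ((outside ∷ X) ≟ₛ A) (f A)))
    (trans (+-cong (∑-≟ X (f ∘ (outside ∷_))) (∑-0 (allSubsets n))) (+-identityʳ _))
  ∑-≟ {suc n} (inside  ∷ X) f = trans (∑-subsets (λ A → when ((inside ∷ X) ≟ₛ A) (f A)))
    (trans (+-cong (∑-0 (allSubsets n)) (∑-≟ X (f ∘ (inside ∷_)))) (+-identityˡ _))

  sign : ∀ {n} → Subset n → Carrier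
  sign []            = 1#
  sign (outside ∷ A) = sign A
  sign (inside  ∷ A) = - sign A

  -- At the first element of `F`, the subsets with it and those without it cancel.
  ∑-sign-⊆ : ∀ {n} (F : Subset n) → ∑ (allSubsets n) (λ A → when (A ⊆? F) (sign A)) ≈ when (F ≟ₛ ⊥) 1#
  ∑-sign-⊆ []            = +-identityʳ 1#
  ∑-sign-⊆ {suc n} (outside ∷ F) = trans (∑-subsets (λ A → when (A ⊆? (outside ∷ F)) (sign A)))
    (trans (+-cong (∑-sign-⊆ F) (∑-0 (allSubsets n))) (+-identityʳ _))
  ∑-sign-⊆ {suc n} (inside ∷ F) = trans (∑-subsets (λ A → when (A ⊆? (inside ∷ F)) (sign A)))
    (trans (sym (∑-+ (allSubsets n))) (trans (∑-cong (allSubsets n) cancel) (∑-0 (allSubsets n))))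
    where
    cancel : ∀ A → when (A ⊆? F) (sign A) + when (A ⊆? F) (- sign A) ≈ 0#
    cancel A = trans (sym (when-+ (A ⊆? F)))
      (trans (when-cong (A ⊆? F) (λ _ → -‿inverseʳ (sign A))) (when-0 (A ⊆? F)))

open import Data.Integer using (ℤ; +_; -[1+_]; _⊖_)

-- The Möbius function as a signed count of subsets.

module Möbius {c ℓ₁ ℓ₂} (F : OrderedField c ℓ₁ ℓ₂) where
  open OrderedField F hiding (zero)
  open OrderedFieldProperties F using (fromℕ-+; x-0≈x)
  open CharacteristicPolynomial F
  open RingSums commutativeRing
  open RingProperties ring
  open CommutativeSemigroupProperties +-commutativeSemigroup using (interchange)
  open ≈-Reasoning setoid

  fromℤ-neg : ∀ z → fromℤ F (ℤ.- z) ≈ - fromℤ F z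
  fromℤ-neg (+ zero)  = sym -0#≈0#
  fromℤ-neg (+ suc m) = refl
  fromℤ-neg -[1+ m ]  = sym (-‿involutive _)

  fromℤ-⊖ : ∀ m n → fromℤ F (m ⊖ n) ≈ fromℕ F m - fromℕ F n
  fromℤ-⊖ m       zero    = sym (x-0≈x _)
  fromℤ-⊖ zero    (suc n) = sym (+-identityˡ _)
  fromℤ-⊖ (suc m) (suc n) = begin
    fromℤ F (suc m ⊖ suc n)                    ≡⟨ ≡.cong (fromℤ F) (ℤ.[1+m]⊖[1+n]≡m⊖n m n) ⟩
    fromℤ F (m ⊖ n)                            ≈⟨ fromℤ-⊖ m n ⟩
    fromℕ F m - fromℕ F n                      ≈⟨ +-identityˡ _ ⟨
    0# + (fromℕ F m - fromℕ F n)               ≈⟨ +-congʳ (-‿inverseʳ 1#) ⟨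
    (1# - 1#) + (fromℕ F m - fromℕ F n)        ≈⟨ interchange 1# (- 1#) (fromℕ F m) (- fromℕ F n) ⟩
    (1# + fromℕ F m) + (- 1# - fromℕ F n)      ≈⟨ +-congˡ (-‿+-comm 1# (fromℕ F n)) ⟩
    (1# + fromℕ F m) - (1# + fromℕ F n)        ∎

  fromℤ-+ : ∀ y z → fromℤ F (y ℤ.+ z) ≈ fromℤ F y + fromℤ F z
  fromℤ-+ (+ m)    (+ n)    = fromℕ-+ m n
  fromℤ-+ (+ m)    -[1+ n ] = fromℤ-⊖ m (suc n)
  fromℤ-+ -[1+ m ] (+ n)    = trans (fromℤ-⊖ n (suc m)) (+-comm _ _)
  fromℤ-+ -[1+ m ] -[1+ n ] = begin
    - fromℕ F (suc (suc (m ℕ.+ n)))            ≡⟨ ≡.cong (λ k → - fromℕ F (suc k)) (ℕ.+-suc m n) ⟨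
    - fromℕ F (suc m ℕ.+ suc n)                ≈⟨ -‿cong (fromℕ-+ (suc m) (suc n)) ⟩
    - (fromℕ F (suc m) + fromℕ F (suc n))      ≈⟨ -‿+-comm _ _ ⟨
    - fromℕ F (suc m) - fromℕ F (suc n)        ∎

  sumR-∑ : ∀ {a} {A : Set a} (h : A → Carrier) xs → sumR F (map h xs) ≈ ∑ xs h
  sumR-∑ h []       = refl
  sumR-∑ h (x ∷ xs) = +-congˡ (sumR-∑ h xs)

  fromℤ-∑ : ∀ {n a} {A : Set a} (M : Matroid n) (h : A → ℤ) xs →
            fromℤ F (sumℤ M (map h xs)) ≈ ∑ xs (fromℤ F ∘ h)
  fromℤ-∑ M h []       = refl
  fromℤ-∑ M h (x ∷ xs) = trans (fromℤ-+ (h x) _) (+-congˡ (fromℤ-∑ M h xs))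

  alternating-suc : ∀ {n} {f : Subset (suc n) → Carrier} s {C : Subset n} L →
    alternating f (s ∷ C) (map suc L) ≈ alternating (λ A → f (s ∷ A)) C L
  alternating-suc         s []      = refl
  alternating-suc {f = f} s {C} (e ∷ L) = +-cong (alternating-suc s L)
    (-‿cong (trans (reflexive (≡.cong (λ b → alternating f (b ∷ C ⊹ e) (map suc L)) (∨-identityʳ s)))
      (alternating-suc s L)))

  -- This form carries an explicit sign for each subset, so its terms can be regrouped by closure.
  alternating-allFin : ∀ n {f : Subset n → Carrier} →
    alternating f ⊥ (allFin n) ≈ ∑ (allSubsets n) (λ A → sign A * f A)
  alternating-allFin zero    {f} = sym (trans (+-identityʳ _) (*-identityˡ (f [])))
  alternating-allFin (suc n) {f} = begin
    alternating f ⊥ (tabulate suc) - alternating f (⊥ ⊹ zero) (tabulate suc)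
      ≡⟨ ≡.cong₂ (λ L C → alternating f ⊥ L - alternating f (inside ∷ C) L)
           (≡.sym (map-tabulate id suc)) (∪-identityˡ ⊥) ⟩
    alternating f ⊥ (map suc (allFin n)) - alternating f (inside ∷ ⊥) (map suc (allFin n))
      ≈⟨ +-cong (half outside) (-‿cong (half inside)) ⟩
    ∑ (allSubsets n) (λ A → sign A * f (outside ∷ A)) - ∑ (allSubsets n) (λ A → sign A * f (inside ∷ A))
      ≈⟨ +-congˡ (trans (sym (∑-neg (allSubsets n))) (∑-cong (allSubsets n) (λ A → -‿distribˡ-* (sign A) _))) ⟩
    ∑ (allSubsets n) (λ A → sign A * f (outside ∷ A)) + ∑ (allSubsets n) (λ A → - sign A * f (inside ∷ A))
      ≈⟨ ∑-subsets (λ A → sign A * f A) ⟨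
    ∑ (allSubsets (suc n)) (λ A → sign A * f A) ∎
    where
    half : ∀ s → alternating f (s ∷ ⊥) (map suc (allFin n)) ≈ ∑ (allSubsets n) (λ A → sign A * f (s ∷ A))
    half s = trans (alternating-suc s (allFin n)) (alternating-allFin n)

  module _ {n} (M : Matroid n) where

    private
      Subsets : List (Subset n)
      Subsets = allSubsets n
      flat? : ∀ (G : Subset n) → Dec (isFlat? M G ≡ true)
      flat? G = isFlat? M G Bool.≟ true
      proper? : ∀ (G H : Subset n) → Dec ((G ⊂ᵇ H) ≡ true)
      proper? G H = (G ⊂ᵇ H) Bool.≟ true

    -- By Whitney's theorem this is μ(∅, G) when G is a flat.
    fibre : Subset n → Carrier
    fibre G = ∑ Subsets (λ A → when (closure M A ≟ₛ G) (sign A))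

    -- After the two sums are exchanged, exactly one flat survives for each `A`, namely its closure.
    ∑-fibre : ∀ (b : Subset n → Carrier) →
              ∑ Subsets (λ G → when (flat? G) (fibre G * b G)) ≈ ∑ Subsets (λ A → sign A * b (closure M A))
    ∑-fibre b = begin
      ∑ Subsets (λ G → when (flat? G) (fibre G * b G))
        ≈⟨ ∑-cong Subsets (λ G → trans (when-cong (flat? G) (λ _ → ∑-*ʳ Subsets (b G))) (∑-when Subsets (flat? G))) ⟩
      ∑ Subsets (λ G → ∑ Subsets (λ A → when (flat? G) (when (closure M A ≟ₛ G) (sign A) * b G)))
        ≈⟨ ∑-swap Subsets Subsets ⟩
      ∑ Subsets (λ A → ∑ Subsets (λ G → when (flat? G) (when (closure M A ≟ₛ G) (sign A) * b G)))
        ≈⟨ ∑-cong Subsets (λ A → ∑-cong Subsets (λ G →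
             trans (when-cong (flat? G) (λ _ → sym (when-*ˡ (closure M A ≟ₛ G)))) (when-comm (flat? G) (closure M A ≟ₛ G)))) ⟩
      ∑ Subsets (λ A → ∑ Subsets (λ G → when (closure M A ≟ₛ G) (when (flat? G) (sign A * b G))))
        ≈⟨ ∑-cong Subsets (λ A → trans (∑-≟ (closure M A) (λ G → when (flat? G) (sign A * b G)))
             (when-yes (flat? _) (isFlat⇐ M (closure-flat M A)))) ⟩
      ∑ Subsets (λ A → sign A * b (closure M A)) ∎

    -- A flat contains the closure of `A` exactly when it contains `A`, so the left side is the
    -- signed count of the subsets of `H`.
    ∑-fibre-⊆ : ∀ {H} → IsFlat M H →
                ∑ Subsets (λ G → when (flat? G) (when (G ⊆? H) (fibre G))) ≈ when (H ≟ₛ ⊥) 1#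
    ∑-fibre-⊆ {H} flat = begin
      ∑ Subsets (λ G → when (flat? G) (when (G ⊆? H) (fibre G)))
        ≈⟨ ∑-cong Subsets (λ G → when-cong (flat? G) (λ _ →
             trans (when-cong (G ⊆? H) (λ _ → sym (*-identityʳ _))) (when-*ʳ (G ⊆? H)))) ⟩
      ∑ Subsets (λ G → when (flat? G) (fibre G * when (G ⊆? H) 1#))
        ≈⟨ ∑-fibre (λ G → when (G ⊆? H) 1#) ⟩
      ∑ Subsets (λ A → sign A * when (closure M A ⊆? H) 1#)
        ≈⟨ ∑-cong Subsets (λ A → trans (sym (when-*ʳ (closure M A ⊆? H)))
             (trans (when-cong (closure M A ⊆? H) (λ _ → *-identityʳ _))
               (when-⇔ (closure M A ⊆? H) (A ⊆? H) (λ cl⊆H → cl⊆H ∘ ⊆-closure M) (closure-⊆ M flat)))) ⟩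
      ∑ Subsets (λ A → when (A ⊆? H) (sign A))  ≈⟨ ∑-sign-⊆ H ⟩
      when (H ≟ₛ ⊥) 1#                          ∎

    split-⊆ : ∀ G H {y} → when (G ⊆? H) y ≈ when (proper? G H) y + when (H ≟ₛ G) y
    split-⊆ G H with H ≟ₛ G
    ... | yes ≡.refl = trans (when-yes (G ⊆? G) id) (trans (sym (+-identityˡ _))
      (+-congʳ (sym (when-no (proper? G G) λ G⊂G → ℕ.<-irrefl ≡.refl (⊂ᵇ⇒∣∣< {X = G} {G} (Equivalence.from T-≡ G⊂G))))))
    ... | no H≢G = trans (when-⇔ (G ⊆? H) (proper? G H)
      (λ G⊆H → Equivalence.to T-≡ (⊆∧≢⇒⊂ᵇ G⊆H (H≢G ∘ ≡.sym))) (λ G⊂H → ⊂ᵇ⇒⊆ {X = G} {H} (Equivalence.from T-≡ G⊂H)))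
      (sym (+-identityʳ _))

    -- This is the recursion that defines μ(∅, H), obtained by splitting off the term `G = H`.
    fibre-recursion : ∀ {H} → IsFlat M H →
      ∑ Subsets (λ G → when (flat? G) (when (proper? G H) (fibre G))) + fibre H ≈ when (H ≟ₛ ⊥) 1#
    fibre-recursion {H} flat = begin
      ∑ Subsets (λ G → when (flat? G) (when (proper? G H) (fibre G))) + fibre H
        ≈⟨ +-congˡ (trans (∑-≟ H (λ G → when (flat? G) (fibre G))) (when-yes (flat? H) (isFlat⇐ M flat))) ⟨
      ∑ Subsets (λ G → when (flat? G) (when (proper? G H) (fibre G)))
        + ∑ Subsets (λ G → when (H ≟ₛ G) (when (flat? G) (fibre G)))
        ≈⟨ ∑-+ Subsets ⟨
      ∑ Subsets (λ G → when (flat? G) (when (proper? G H) (fibre G)) + when (H ≟ₛ G) (when (flat? G) (fibre G)))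
        ≈⟨ ∑-cong Subsets (λ G → trans (+-congˡ (when-comm (H ≟ₛ G) (flat? G))) (trans (sym (when-+ (flat? G)))
             (when-cong (flat? G) (λ _ → sym (split-⊆ G H))))) ⟩
      ∑ Subsets (λ G → when (flat? G) (when (G ⊆? H) (fibre G)))  ≈⟨ ∑-fibre-⊆ flat ⟩
      when (H ≟ₛ ⊥) 1#  ∎

    fibre-⊥ : IsFlat M ⊥ → fibre (⊥ {n}) ≈ 1#
    fibre-⊥ flat = begin
      fibre ⊥                                    ≈⟨ ∑-cong Subsets (λ A → when-⇔ (closure M A ≟ₛ ⊥) (A ⊆? ⊥) (to A) (from A)) ⟩
      ∑ Subsets (λ A → when (A ⊆? ⊥) (sign A))   ≈⟨ ∑-sign-⊆ {n} ⊥ ⟩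
      when (⊥ {n} ≟ₛ ⊥) 1#                       ≈⟨ when-yes (⊥ {n} ≟ₛ ⊥) ≡.refl ⟩
      1#                                         ∎
      where
      to : ∀ A → closure M A ≡ ⊥ → A ⊆ ⊥
      to A cl≡⊥ = ≡.subst (A ⊆_) cl≡⊥ (⊆-closure M)
      from : ∀ A → A ⊆ ⊥ → closure M A ≡ ⊥
      from A A⊆⊥ = ⊆-antisym (closure-⊆ M flat A⊆⊥) ⊥⊆

    module _ (flat-⊥ : IsFlat M ⊥) where

      -- `μ-aux` hands the same fuel to every smaller flat, so the induction has to allow any fuel
      -- that is at least |H|.
      fromℤ-μ-aux : ∀ k H → IsFlat M H → ∣ H ∣ ℕ.≤ k → fromℤ F (μ-aux M k H) ≈ fibre H
      fromℤ-μ-aux k H flat H≤k with H ≟ₛ ⊥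
      -- Without fuel `H` is empty, so the default `+ 1` is the correct value; its image in the
      -- field is `1# + 0#`.
      fromℤ-μ-aux zero    .⊥ flat _ | yes ≡.refl = trans (+-identityʳ 1#) (sym (fibre-⊥ flat-⊥))
      fromℤ-μ-aux (suc k) .⊥ flat _ | yes ≡.refl rewrite ∣⊥∣≡0 n = trans (+-identityʳ 1#) (sym (fibre-⊥ flat-⊥))
      fromℤ-μ-aux k H flat H≤k | no H≢⊥ with nonempty? H
      ... | no  empty = contradiction (Empty-unique empty) H≢⊥
      ... | yes (e , e∈H) = nonempty k H≤k
        where
        0<∣H∣ : 0 ℕ.< ∣ H ∣
        0<∣H∣ = ≡.subst (ℕ._≤ ∣ H ∣) (∣⁅x⁆∣≡1 e) (p⊆q⇒∣p∣≤∣q∣ (⁅⁆-⊆ e∈H))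
        ∣H∣≢ᵇ0 : (∣ H ∣ ℕ.≡ᵇ 0) ≡ false
        ∣H∣≢ᵇ0 with ∣ H ∣ | 0<∣H∣
        ... | suc _ | _ = ≡.refl
        below : ℕ → List (Subset n) → ℤ
        below k Gs = sumℤ M (map (μ-aux M k) (filter (λ G → proper? G H) Gs))
        nonempty : ∀ k → ∣ H ∣ ℕ.≤ k → fromℤ F (μ-aux M k H) ≈ fibre H
        nonempty zero    H≤0 = contradiction (ℕ.≤-trans 0<∣H∣ H≤0) λ ()
        nonempty (suc k) H≤k = begin
          fromℤ F (μ-aux M (suc k) H)
            ≡⟨ ≡.cong (λ b → fromℤ F (if b then + 1 else ℤ.- below k (flats M))) ∣H∣≢ᵇ0 ⟩
          fromℤ F (ℤ.- below k (flats M))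
            ≈⟨ trans (fromℤ-neg (below k (flats M)))
                 (-‿cong (fromℤ-∑ M (μ-aux M k) (filter (λ G → proper? G H) (flats M)))) ⟩
          - ∑ (filter (λ G → proper? G H) (flats M)) (λ G → fromℤ F (μ-aux M k G))
            ≈⟨ -‿cong (trans (∑-filter (λ G → proper? G H) (flats M)) (∑-filter flat? Subsets)) ⟩
          - ∑ Subsets (λ G → when (flat? G) (when (proper? G H) (fromℤ F (μ-aux M k G))))
            ≈⟨ -‿cong (∑-cong Subsets (λ G → when-cong (flat? G) (λ flatG → when-cong (proper? G H) (λ G⊂H →
                 fromℤ-μ-aux k G (isFlat⇒ M flatG)
                   (ℕ.s≤s⁻¹ (ℕ.≤-trans (⊂ᵇ⇒∣∣< {X = G} {H} (Equivalence.from T-≡ G⊂H)) H≤k)))))) ⟩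
          - ∑ Subsets (λ G → when (flat? G) (when (proper? G H) (fibre G)))
            ≈⟨ +-inverseʳ-unique _ _ (trans (fibre-recursion flat) (when-no (H ≟ₛ ⊥) H≢⊥)) ⟨
          fibre H ∎

    charPoly-loop : loopless? M ≡ false → ∀ x → charPoly F M x ≈ 0#
    charPoly-loop loop x rewrite loop = refl

    module _ (loopless : loopless? M ≡ true) where

      nonloops : ∀ e → Nonloop M ⊥ e
      nonloops e = ℕ.≤-trans (ℕ.s≤s (ℕ.≤-trans (rank-bound M ⊥) (ℕ.≤-reflexive (∣⊥∣≡0 n))))
        (≡.subst (λ X → 0 ℕ.< rank M X) (≡.sym (∪-identityˡ ⁅ e ⁆)) (ℕ.<ᵇ⇒< _ _
          (All.lookup (All.all⁺ (λ e → 0 ℕ.<ᵇ rank M ⁅ e ⁆) (allFin n) (Equivalence.from T-≡ loopless)) (∈-allFin e))))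

      -- A set has the rank of its closure, so the sum over flats weighted by `fibre` unfolds into
      -- Whitney's sum over all subsets.
      charPoly≈χ : ∀ x → charPoly F M x ≈ χ M x ⊥ (allFin n)
      charPoly≈χ x rewrite loopless = begin
        sumR F (map (λ G → fromℤ F (μ₀ M G) * b G) (flats M))
          ≈⟨ trans (sumR-∑ _ (flats M)) (∑-filter flat? Subsets) ⟩
        ∑ Subsets (λ G → when (flat? G) (fromℤ F (μ₀ M G) * b G))
          ≈⟨ ∑-cong Subsets (λ G → when-cong (flat? G) (λ flatG →
               *-congʳ (fromℤ-μ-aux (λ e _ → nonloops e) ∣ G ∣ G (isFlat⇒ M flatG) ℕ.≤-refl))) ⟩
        ∑ Subsets (λ G → when (flat? G) (fibre G * b G))  ≈⟨ ∑-fibre b ⟩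
        ∑ Subsets (λ A → sign A * b (closure M A))
          ≈⟨ ∑-cong Subsets (λ A → *-congˡ (reflexive (≡.cong (λ m → pow F x (rank M ⊤ ∸ m)) (rank-closure M A)))) ⟩
        ∑ Subsets (λ A → sign A * b A)                    ≈⟨ alternating-allFin n ⟨
        alternating b ⊥ (allFin n)
          ≡⟨ ≡.cong (λ X → alternating (λ A → pow F x (rank M X ∸ rank M A)) ⊥ (allFin n)) span-allFin ⟨
        χ M x ⊥ (allFin n)                                ∎
        where
        b : Subset n → Carrier
        b G = pow F x (rank M ⊤ ∸ rank M G)
        span-allFin : span ⊥ (allFin n) ≡ ⊤
        span-allFin = ⊆-antisym ⊆⊤ (λ {e} _ → ∈-span (∈-allFin e))

-- The threshold, and the case of a loop.

open import Data.Nat using (_≤_; _^_; _+_)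

-- The hypothesis is (q^k - 1)/(q - 1) < x with the denominator cleared; `geometric-pow` exhibits
-- the positive factor q - 1 on the left, which is then cancelled.
geometric<x : ∀ {c ℓ₁ ℓ₂} (F : OrderedField c ℓ₁ ℓ₂) → let open OrderedField F in
              ∀ q k {x} → 2 ≤ q →
              fromℕ F (q ^ k ∸ 1) < fromℕ F (q ∸ 1) * x → fromℕ F (geometric q k) < x
geometric<x F (suc (suc q)) k (ℕ.s≤s (ℕ.s≤s _)) x-large = *-cancelˡ-<
  (<-≤-trans 0<1 (≤-trans (≤-reflexive (sym (+-identityʳ 1#))) (fromℕ-mono {1} {suc q} (ℕ.s≤s ℕ.z≤n))))
  (<-respˡ-≈ (trans (reflexive (≡.cong (fromℕ F) (≡.sym (geometric-pow (suc q) k))))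
    (fromℕ-* (suc q) (geometric (suc (suc q)) k))) x-large)
  where
  open OrderedField F using (1#; sym; trans; reflexive; +-identityʳ)
  open OrderedFieldProperties F

theorem1p4 : ∀ {c ℓ₁ ℓ₂ : Level} (R : OrderedField c ℓ₁ ℓ₂)
    (q k n : ℕ) → 2 ≤ q → 1 ≤ k → (M : Matroid n) →
    TreeWidth≤ M k →
    ¬ HasMinorIsoTo (uniformRank 2 {2 + q}) M →
    let open OrderedField R in
    (∀ x → charPoly R M x ≈ 0#)
    ⊎ (∀ x → fromℕ R (q ^ k ∸ 1) < fromℕ R (q ∸ 1) * x → 0# < charPoly R M x)
theorem1p4 R q k n 2≤q _ M (T , width) noLine = by-loops (loopless? M) ≡.refl
  where
  open OrderedField R
  open OrderedFieldProperties R using (<-respʳ-≈)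
  open Möbius R using (charPoly-loop; charPoly≈χ; nonloops)
  open Positivity R using (χ-pos)
  -- The alternative in the theorem is decided by whether `M` has a loop.
  by-loops : ∀ b → loopless? M ≡ b → (∀ x → charPoly R M x ≈ 0#)
    ⊎ (∀ x → fromℕ R (q ^ k ∸ 1) < fromℕ R (q ∸ 1) * x → 0# < charPoly R M x)
  by-loops false loop     = inj₁ (charPoly-loop M loop)
  by-loops true  loopless = inj₂ λ x x-large → <-respʳ-≈ (sym (charPoly≈χ M loopless x))
    (χ-pos M x T width noLine (geometric<x R q k 2≤q x-large) _ ⊥ (allFin n) ℕ.≤-refl
      (All.tabulate λ {e} _ → nonloops M loopless e))
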